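{- Every 3-CNF theory (respectively, every normal 3-program, every disjunctive 3-program) with $n$ atoms has at most $c^n$ minimal models (respectively, stable models, answer sets), where $c = 1.6701\ldots$.
   Context: A $t$-CNF theory is a finite set of propositional clauses, each containing at most $t$ literals; clauses contain no repeated literal and no pair of complementary literals. A normal program clause has the form $a \leftarrow b_1,\ldots,b_r,\mathbf{not}(c_1),\ldots,\mathbf{not}(c_s)$ and a disjunctive program clause the form $a_1\vee\cdots\vee a_p \leftarrow b_1,\ldots,b_r,\mathbf{not}(c_1),\ldots,\mathbf{not}(c_s)$; a (normal or disjunctive) $t$-program is a finite set of such clauses, each with at most $t$ literals. Models, stable models (Gelfond–Lifschitz) and answer sets (minimal models of the Gelfond–Lifschitz reduct $P^M$) are represented as sets of true atoms; a model is minimal if no proper subset is a model. $n$ is the number of atoms. The constant $c=1.6701\ldots$ is the real number $\tau>1$ for which there is $\alpha\in(0,1)$ (namely $\alpha=0.1950\ldots$) such that $\tau$ is simultaneously the root greater than $1$ of $\tau^{ -1+\alpha}+\tau^{ -4+3\alpha}+2\tau^{ -6+4\alpha}+\tau^{ -8+5\alpha}=1$ and of $\tau^{ -1}+\tau^{ -1-4\alpha}=1$. -}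

module Defs where

open import Data.Nat using (ℕ; _+_; _*_; _^_; _≤_)
open import Data.Fin using (Fin)
open import Data.Fin.Subset using (Subset; _∈_; _∉_; _⊆_; _⊂_)
open import Data.Fin.Subset.Properties using (_∈?_)
open import Data.List using (List; length; filter; map)
import Data.List.Membership.Propositional as LM
open import Data.List.Relation.Unary.All using (All; all?)
open import Data.List.Relation.Unary.Any using (Any)
open import Data.List.Relation.Unary.Unique.Propositional using (Unique)
open import Data.Product using (_×_; _,_)
open import Relation.Nullary using (¬_)
open import Relation.Nullary.Decidable using (¬?)

-- Interpretations: atoms are Fin n; an interpretation is the set of
-- true atoms, a Subset n (= Vec Bool n, so equality is decidable and
-- "distinct interpretations" is meaningful).

data Literal (n : ℕ) : Set where
  pos : Fin n → Literal n
  neg : Fin n → Literal n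

Clause : ℕ → Set
Clause n = List (Literal n)

Theory : ℕ → Set
Theory n = List (Clause n)

WellFormedClause : ∀ {n} → Clause n → Set
WellFormedClause {n} C =
  Unique C × (∀ (a : Fin n) → ¬ ((pos a LM.∈ C) × (neg a LM.∈ C)))

IsCNF : ∀ {n} → ℕ → Theory n → Set
IsCNF t T = All (λ C → WellFormedClause C × length C ≤ t) T

LitTrue : ∀ {n} → Subset n → Literal n → Set
LitTrue M (pos a) = a ∈ M
LitTrue M (neg a) = a ∉ M

IsModel : ∀ {n} → Theory n → Subset n → Set
IsModel T M = All (λ C → Any (LitTrue M) C) T

IsMinimalModel : ∀ {n} → Theory n → Subset n → Set
IsMinimalModel T M = IsModel T M × (∀ N → N ⊂ M → ¬ IsModel T N)

record NClause (n : ℕ) : Set where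
  constructor _⇐_,not_
  field
    head    : Fin n
    posBody : List (Fin n)
    negBody : List (Fin n)
open NClause public

NProgram : ℕ → Set
NProgram n = List (NClause n)

IsNormalProgram : ∀ {n} → ℕ → NProgram n → Set
IsNormalProgram t P = All (λ C → 1 + length (posBody C) + length (negBody C) ≤ t) P

HornClause : ℕ → Set
HornClause n = Fin n × List (Fin n)

IsHornModel : ∀ {n} → List (HornClause n) → Subset n → Set
IsHornModel P N = All (λ { (h , b) → All (_∈ N) b → h ∈ N }) P

NReduct : ∀ {n} → NProgram n → Subset n → List (HornClause n)
NReduct P M =
  map (λ C → head C , posBody C)
      (filter (λ C → all? (λ c → ¬? (c ∈? M)) (negBody C)) P)

IsStableModel : ∀ {n} → NProgram n → Subset n → Set
IsStableModel P M =
  IsHornModel (NReduct P M) M × (∀ N → IsHornModel (NReduct P M) N → M ⊆ N)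

record DClause (n : ℕ) : Set where
  constructor _⇐ᵈ_,not_
  field
    dhead    : List (Fin n)
    dposBody : List (Fin n)
    dnegBody : List (Fin n)
open DClause public

DProgram : ℕ → Set
DProgram n = List (DClause n)

IsDisjunctiveProgram : ∀ {n} → ℕ → DProgram n → Set
IsDisjunctiveProgram t P =
  All (λ C → 1 ≤ length (dhead C)
           × length (dhead C) + length (dposBody C) + length (dnegBody C) ≤ t) P

PosDClause : ℕ → Set
PosDClause n = List (Fin n) × List (Fin n)

IsPosDModel : ∀ {n} → List (PosDClause n) → Subset n → Set
IsPosDModel P N = All (λ { (hs , b) → All (_∈ N) b → Any (_∈ N) hs }) P

DReduct : ∀ {n} → DProgram n → Subset n → List (PosDClause n)
DReduct P M =
  map (λ C → dhead C , dposBody C)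
      (filter (λ C → all? (λ c → ¬? (c ∈? M)) (dnegBody C)) P)

IsAnswerSet : ∀ {n} → DProgram n → Subset n → Set
IsAnswerSet P M =
  IsPosDModel (DReduct P M) M × (∀ N → N ⊂ M → ¬ IsPosDModel (DReduct P M) N)

-- The constant c = 1.6701...
--
-- Write x = τ^(-α).  The second defining equation τ⁻¹ + τ^(-1-4α) = 1
-- reads τ = 1 + x⁴, and the first reads
--   τ⁻¹x⁻¹ + τ⁻⁴x⁻³ + 2τ⁻⁶x⁻⁴ + τ⁻⁸x⁻⁵ = 1.
-- For a positive rational x = p/q, put τ = 1 + x⁴ = T / q⁴ with
-- T = q⁴ + p⁴.  AboveC p q says the left-hand side of the first
-- equation is ≤ 1 (multiplied through by T⁸p⁵); for x > 0 this holds
-- exactly when x ≥ x₀ = (c - 1)^(1/4), i.e. when τ = 1 + x⁴ ≥ c.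

τNum : ℕ → ℕ → ℕ
τNum p q = q ^ 4 + p ^ 4

AboveC : ℕ → ℕ → Set
AboveC p q =
  q ^ 5 * τNum p q ^ 7 * p ^ 4 + q ^ 19 * τNum p q ^ 4 * p ^ 2
    + 2 * q ^ 28 * τNum p q ^ 2 * p + q ^ 37
  ≤ τNum p q ^ 8 * p ^ 5

-- k ≤ τⁿ where τ = 1 + (p/q)⁴, i.e. k · (q⁴)ⁿ ≤ (q⁴ + p⁴)ⁿ
AtMostτPow : ℕ → ℕ → ℕ → ℕ → Set
AtMostτPow n p q k = k * (q ^ 4) ^ n ≤ τNum p q ^ n

{-# OPTIONS --safe #-}
-- Answer sets and stable models are minimal models of the clausal reading of
-- the program, so only minimal models of a 3-CNF theory have to be counted.
-- Every true atom a of a minimal model has a critical clause, one in which a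
-- is the only true literal.
--
-- Since c > 1.67, it is enough to bound the number of minimal models by
-- (167/100)ⁿ. A partially assigned theory with n free atoms and k pairwise
-- disjoint 2-clauses is shown to have at most (167/100)ⁿ (28/31)ᵏ minimal
-- models, by branching. Setting a literal to false turns its 3-clauses into
-- 2-clauses; a new 2-clause is either disjoint from the k old ones and raises
-- k, or meets one of them and admits a good branching. For k ≥ 1 one branches
-- on the literals of a 2-clause, using the critical clauses when one of its
-- atoms has few occurrences. For k = 0 an atom with at most two positive
-- occurrences has few candidates for its critical clause; otherwise all
-- occurrences may be taken positive and one branches on an atom with the most
-- occurrences, after which an atom sharing clauses with it has few left.
module Submission where

open import Defs
open import Data.Bool using (T)
open import Data.Empty using (⊥; ⊥-elim)
open import Data.Fin using (Fin) renaming (_≟_ to _≟ᶠ_)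
open import Data.Fin.Subset using (Subset; _-_) renaming (_∈_ to _∈ˢ_; _⊂_ to _⊂ˢ_)
open import Data.Fin.Subset.Properties using (⊆-antisym; x∈p⇒p-x⊂p; x∈p∧x≢y⇒x∈p-y) renaming (_∈?_ to _∈ˢ?_)
open import Data.List using (List; []; _∷_; _++_; length; map; filter; allFin; deduplicate)
open import Data.List.Membership.Propositional using (_∈_; find; lose)
open import Data.List.Membership.Propositional.Properties
  using (∈-filter⁺; ∈-filter⁻; ∈-map⁺; ∈-map⁻; ∈-++⁺ˡ; ∈-++⁺ʳ; ∈-++⁻; ∈-allFin; ∈-deduplicate⁺; ∈-deduplicate⁻)
open import Data.List.Properties
  using (length-filter; length-tabulate; length-deduplicate; length-map; length-++;
         filter-notAll; filter-all; filter-some; filter-accept; filter-reject)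
  renaming (≡-dec to List-≡-dec)
open import Data.List.Relation.Binary.Sublist.Propositional using ([]; _∷_; _∷ʳ_) renaming (_⊆_ to _⊑_)
open import Data.List.Relation.Binary.Sublist.Propositional.Properties using (All-resp-⊆)
open import Data.List.Relation.Binary.Subset.Propositional using (_⊆_)
open import Data.List.Relation.Unary.All as All using (All; []; _∷_)
import Data.List.Relation.Unary.All.Properties as All
open import Data.List.Relation.Unary.AllPairs as AllPairs using (AllPairs; []; _∷_)
import Data.List.Relation.Unary.AllPairs.Properties as AllPairs
open import Data.List.Relation.Unary.Any as Any using (Any; here; there; any?)
import Data.List.Relation.Unary.Any.Properties as Any
open import Data.List.Relation.Unary.Unique.DecPropositional.Properties using (deduplicate-!)
open import Data.List.Relation.Unary.Unique.Propositional using (Unique)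
open import Data.Nat using (ℕ; zero; suc; _+_; _*_; _∸_; _^_; _≤_; _<_; _≤ᵇ_; _≤?_; z≤n; s≤s; NonZero; >-nonZero)
open import Data.Nat.Properties hiding (_≟_; _≤?_)
open import Data.Nat.Properties using () renaming (_≟_ to _≟ⁿ_)
open import Data.Nat.Tactic.RingSolver using (solve-∀)
open import Data.Product using (∃; _×_; _,_; proj₁; proj₂; swap)
open import Data.Product.Properties using (≡-dec)
open import Data.Sum using (_⊎_; inj₁; inj₂; [_,_]′)
open import Function using (_∘_; _on_)
open import Relation.Binary.PropositionalEquality using (_≡_; _≢_; refl; sym; trans; cong; cong₂; subst; ≢-sym)
open import Relation.Nullary using (¬_; Dec; yes; no; contradiction)
open import Relation.Nullary.Decidable using (¬?; map′; decidable-stable; _⊎-dec_; _×-dec_)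

-- Put τ = 167/100 and x = 28/31. A branch that assigns a atoms and destroys b pairs costs τ^(-a)
-- x^(-b), so every case ends in a closed inequality between numerals. That τ lies a little below c
-- leaves the slack in which contributions can be rounded up to multiples of 1/10000. The value of x
-- is squeezed from two sides. An atom with four occurrences in otherwise disjoint clauses costs 1/τ
-- + x⁴/τ, the left side of the second equation that defines c; this must be at most 1 and bounds x
-- from above. A branch that merely destroys a pair costs 1/(τx), which bounds x from below; the
-- case of a pair with three further occurrences of one of its atoms is tight. So x sits just below
-- (c - 1)^(1/4). The obstacle is that the 2-clauses created by a branch may overlap the pairs and
-- one another, whereas only disjoint ones may enter the measure. Extra coefficients, indexed by the
-- number of such 2-clauses, express what overlapping ones are worth.

private variable
  N : ℕ

-- Weighted counting

^-cross : ∀ {p q i j} → p ≤ q → i ≤ j → p ^ j * q ^ i ≤ p ^ i * q ^ j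
^-cross {p} {q} {i} {j} p≤q i≤j with m≤n⇒∃[o]m+o≡n i≤j
... | d , refl = begin
  p ^ (i + d) * q ^ i        ≡⟨ cong (_* q ^ i) (^-distribˡ-+-* p i d) ⟩
  p ^ i * p ^ d * q ^ i      ≤⟨ *-monoˡ-≤ (q ^ i) (*-monoʳ-≤ (p ^ i) (^-monoˡ-≤ d p≤q)) ⟩
  p ^ i * q ^ d * q ^ i      ≡⟨ *-assoc (p ^ i) (q ^ d) (q ^ i) ⟩
  p ^ i * (q ^ d * q ^ i)    ≡⟨ cong (p ^ i *_) (trans (*-comm (q ^ d) (q ^ i)) (sym (^-distribˡ-+-* q i d))) ⟩
  p ^ i * q ^ (i + d)        ∎
  where open ≤-Reasoning

-- Card P c n k: at most (c / 10⁴) · (167/100)ⁿ · (28/31)ᵏ elements satisfy P.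
record Card {A : Set} (P : A → Set) (c n k : ℕ) : Set where
  constructor card
  field
    bound : ∀ {ms} → Unique ms → All P ms →
            length ms * (10000 * (100 ^ n * 31 ^ k)) ≤ c * (167 ^ n * 28 ^ k)
open Card

-- c′ is at least the contribution of a branch that assigns a atoms, destroys b
-- pairs, creates g pairs and has coefficient c; the numerals used for c′ below
-- are these contributions rounded up.
record Fits (c a b g c′ : ℕ) : Set where
  constructor fits
  field
    check : T (c * (100 ^ a * (31 ^ b * 28 ^ g)) ≤ᵇ c′ * (167 ^ a * (28 ^ b * 31 ^ g)))

private
  rescale : ∀ {L D c c′ v v′ w w′ u u′} .{{_ : NonZero (w * u)}} →
            L * (D * v) ≤ c * w → v′ * w * u ≤ v * w′ * u′ → c * u′ ≤ c′ * u →
            L * (D * v′) ≤ c′ * w′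
  rescale {L} {D} {c} {c′} {v} {v′} {w} {w′} {u} {u′} bd cross check =
    *-cancelʳ-≤ _ _ (w * u) (begin
      L * (D * v′) * (w * u)    ≡⟨ e₁ L D v′ w u ⟩
      L * D * (v′ * w * u)      ≤⟨ *-monoʳ-≤ (L * D) cross ⟩
      L * D * (v * w′ * u′)     ≡⟨ e₂ L D v w′ u′ ⟩
      L * (D * v) * (w′ * u′)   ≤⟨ *-monoˡ-≤ (w′ * u′) bd ⟩
      c * w * (w′ * u′)         ≡⟨ e₃ c w w′ u′ ⟩
      c * u′ * (w * w′)         ≤⟨ *-monoˡ-≤ (w * w′) check ⟩
      c′ * u * (w * w′)         ≡⟨ e₄ c′ u w w′ ⟩
      c′ * w′ * (w * u)         ∎)
    where
    open ≤-Reasoning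
    e₁ : ∀ L D v w u → L * (D * v) * (w * u) ≡ L * D * (v * w * u)
    e₁ = solve-∀
    e₂ : ∀ L D v w u → L * D * (v * w * u) ≡ L * (D * v) * (w * u)
    e₂ = solve-∀
    e₃ : ∀ c w x u → c * w * (x * u) ≡ c * u * (w * x)
    e₃ = solve-∀
    e₄ : ∀ c u w x → c * u * (w * x) ≡ c * x * (w * u)
    e₄ = solve-∀

  -- td, tn, xd, xn stand for 100, 167, 31, 28.
  cross : ∀ {td tn xd xn n n′ k k′} a b g → td ≤ tn → xn ≤ xd → n′ + a ≤ n → k + g ≤ k′ + b →
          (td ^ n * xd ^ k) * (tn ^ n′ * xn ^ k′) * (tn ^ a * (xn ^ b * xd ^ g))
            ≤ (td ^ n′ * xd ^ k′) * (tn ^ n * xn ^ k) * (td ^ a * (xd ^ b * xn ^ g))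
  cross {td} {tn} {xd} {xn} {n} {n′} {k} {k′} a b g t≤ x≤ n≤ k≤ = begin
    (td ^ n * xd ^ k) * (tn ^ n′ * xn ^ k′) * (tn ^ a * (xn ^ b * xd ^ g))
      ≡⟨ e₁ (td ^ n) (xd ^ k) (tn ^ n′) (xn ^ k′) (tn ^ a) (xn ^ b) (xd ^ g) ⟩
    (td ^ n * (tn ^ n′ * tn ^ a)) * ((xn ^ k′ * xn ^ b) * (xd ^ k * xd ^ g))
      ≡⟨ cong₂ _*_ (cong (td ^ n *_) (sym (^-distribˡ-+-* tn n′ a)))
                   (cong₂ _*_ (sym (^-distribˡ-+-* xn k′ b)) (sym (^-distribˡ-+-* xd k g))) ⟩
    (td ^ n * tn ^ (n′ + a)) * (xn ^ (k′ + b) * xd ^ (k + g))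
      ≤⟨ *-mono-≤ (^-cross {td} {tn} t≤ n≤) (^-cross {xn} {xd} x≤ k≤) ⟩
    (td ^ (n′ + a) * tn ^ n) * (xn ^ (k + g) * xd ^ (k′ + b))
      ≡⟨ cong₂ _*_ (cong (_* tn ^ n) (^-distribˡ-+-* td n′ a))
                   (cong₂ _*_ (^-distribˡ-+-* xn k g) (^-distribˡ-+-* xd k′ b)) ⟩
    (td ^ n′ * td ^ a * tn ^ n) * ((xn ^ k * xn ^ g) * (xd ^ k′ * xd ^ b))
      ≡⟨ e₂ (td ^ n′) (td ^ a) (tn ^ n) (xn ^ k) (xn ^ g) (xd ^ k′) (xd ^ b) ⟩
    (td ^ n′ * xd ^ k′) * (tn ^ n * xn ^ k) * (td ^ a * (xd ^ b * xn ^ g)) ∎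
    where
    open ≤-Reasoning
    e₁ : ∀ A B C D E F G → (A * B) * (C * D) * (E * (F * G)) ≡ (A * (C * E)) * ((D * F) * (B * G))
    e₁ = solve-∀
    e₂ : ∀ A B C D E F G → (A * B * C) * ((D * E) * (F * G)) ≡ (A * F) * (C * D) * (B * (G * E))
    e₂ = solve-∀

  scale-nonzero : ∀ {tn xd xn} → .{{NonZero tn}} → .{{NonZero xd}} → .{{NonZero xn}} → ∀ n k a b g →
             NonZero ((tn ^ n * xn ^ k) * (tn ^ a * (xn ^ b * xd ^ g)))
  scale-nonzero {tn} {xd} {xn} n k a b g =
    m*n≢0 _ _ {{m*n≢0 _ _ {{m^n≢0 tn n}} {{m^n≢0 xn k}}}}
          {{m*n≢0 _ _ {{m^n≢0 tn a}} {{m*n≢0 _ _ {{m^n≢0 xn b}} {{m^n≢0 xd g}}}}}}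

module _ {A : Set} where

  private variable
    P Q R : A → Set
    c c′ c″ n n′ k k′ : ℕ

  Card-⊆ : (∀ {M} → P M → Q M) → Card Q c n k → Card P c n k
  Card-⊆ {P = P} {Q = Q} f b = card λ u ps → bound b u (all ps)
    where
    all : ∀ {ms} → All P ms → All Q ms
    all []       = []
    all (p ∷ ps) = f p ∷ all ps

  -- Since 100/167 and 28/31 are below 1, fewer free atoms or more pairs than promised only lower
  -- the weight, so inequalities on `n′` and `k′` suffice. Destroyed and created pairs stand on
  -- opposite sides to avoid subtraction.
  Card-shift : ∀ a b g → n′ + a ≤ n → k + g ≤ k′ + b →
               Fits c a b g c′ →
               Card P c n′ k′ → Card P c′ n k
  Card-shift {n′ = n′} {n = n} {k = k} {k′ = k′} {c = c} {c′ = c′} a b g n≤ k≤ (fits check) cp = card λ {ms} u ps →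
    rescale {length ms} {10000} {c} {c′} {100 ^ n′ * 31 ^ k′} {100 ^ n * 31 ^ k}
            {167 ^ n′ * 28 ^ k′} {167 ^ n * 28 ^ k}
            {167 ^ a * (28 ^ b * 31 ^ g)} {100 ^ a * (31 ^ b * 28 ^ g)}
            {{scale-nonzero n′ k′ a b g}}
      (bound cp u ps) (cross a b g (≤ᵇ⇒≤ 100 167 _) (≤ᵇ⇒≤ 28 31 _) n≤ k≤) (≤ᵇ⇒≤ _ _ check)

  Card-mono : T (c ≤ᵇ c′) → Card P c n k → Card P c′ n k
  Card-mono {c} {c′} c≤ cp = card λ u ps → ≤-trans (bound cp u ps) (*-monoˡ-≤ _ (≤ᵇ⇒≤ c c′ c≤))

  private
    separate : (∀ {M} → P M → Q M ⊎ R M) → ∀ {ms} → All P ms →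
               ∃ λ qs → ∃ λ rs → (qs ⊑ ms × All Q qs) × (rs ⊑ ms × All R rs)
                 × length ms ≡ length qs + length rs
    separate f []       = [] , [] , ([] , []) , ([] , []) , refl
    separate f {M ∷ _} (p ∷ ps) with f p | separate f ps
    ... | inj₁ q | qs , rs , (sq , aq) , (sr , ar) , e =
      M ∷ qs , rs , (refl ∷ sq , q ∷ aq) , (M ∷ʳ sr , ar) , cong suc e
    ... | inj₂ r | qs , rs , (sq , aq) , (sr , ar) , e =
      qs , M ∷ rs , (M ∷ʳ sq , aq) , (refl ∷ sr , r ∷ ar) , trans (cong suc e) (sym (+-suc _ _))

    unique-⊑ : {qs ms : List A} → qs ⊑ ms → Unique ms → Unique qs
    unique-⊑ []         []       = []
    unique-⊑ (_ ∷ʳ s)   (_ ∷ u)  = unique-⊑ s u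
    unique-⊑ (refl ∷ s) (x ∷ u)  = All-resp-⊆ s x ∷ unique-⊑ s u

  Card-+ : Card Q c n k → Card R c′ n k → Card (λ M → Q M ⊎ R M) (c + c′) n k
  Card-+ {c = c} {n = n} {k = k} {c′ = c′} cq cr = card λ u ps → go u (separate (λ x → x) ps)
    where
    go : ∀ {ms} → Unique ms → _ → length ms * (10000 * (100 ^ n * 31 ^ k)) ≤ (c + c′) * (167 ^ n * 28 ^ k)
    go {ms} u (qs , rs , (sq , aq) , (sr , ar) , e) = subst (λ L → L * V ≤ (c + c′) * W) (sym e)
      (subst (_≤ (c + c′) * W) (sym (*-distribʳ-+ V (length qs) (length rs)))
        (subst (length qs * V + length rs * V ≤_) (sym (*-distribʳ-+ W c c′))
          (+-mono-≤ (bound cq (unique-⊑ sq u) aq) (bound cr (unique-⊑ sr u) ar))))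
      where
      V = 10000 * (100 ^ n * 31 ^ k)
      W = 167 ^ n * 28 ^ k

  Card-⊎ : (∀ {M} → P M → Q M ⊎ R M) → Card Q c n k → Card R c′ n k → T (c + c′ ≤ᵇ c″) → Card P c″ n k
  Card-⊎ f cq cr c≤ = Card-mono c≤ (Card-⊆ f (Card-+ cq cr))

  Card-∅ : (∀ {M} → P M → ⊥) → Card P c n k
  Card-∅ {P = P} {c = c} {n = n} {k = k} ¬p = card λ _ → empty
    where
    empty : ∀ {ms} → All P ms → length ms * (10000 * (100 ^ n * 31 ^ k)) ≤ c * (167 ^ n * 28 ^ k)
    empty []      = z≤n
    empty (p ∷ _) = ⊥-elim (¬p p)

  Card-prop : (∀ {M M′} → P M → P M′ → M ≡ M′) → Card P 10000 0 0
  Card-prop {P = P} prop = card small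
    where
    small : ∀ {ms} → Unique ms → All P ms → length ms * (10000 * 1) ≤ 10000 * 1
    small []                _           = z≤n
    small (_ ∷ [])          _           = ≤-refl
    small ((x≢y ∷ _) ∷ _ ∷ _) (p ∷ q ∷ _) = ⊥-elim (x≢y (prop p q))

-- Literals and states

atom : Literal N → Fin N
atom (pos a) = a
atom (neg a) = a

opp : Literal N → Literal N
opp (pos a) = neg a
opp (neg a) = pos a

_≟_ : (l m : Literal N) → Dec (l ≡ m)
pos a ≟ pos b = map′ (cong pos) (cong atom) (a ≟ᶠ b)
pos _ ≟ neg _ = no λ ()
neg _ ≟ pos _ = no λ ()
neg a ≟ neg b = map′ (cong neg) (cong atom) (a ≟ᶠ b)

opp-opp : (l : Literal N) → opp (opp l) ≡ l
opp-opp (pos _) = refl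
opp-opp (neg _) = refl

atom-opp : (l : Literal N) → atom (opp l) ≡ atom l
atom-opp (pos _) = refl
atom-opp (neg _) = refl

l≢opp : (l : Literal N) → l ≢ opp l
l≢opp (pos _) ()
l≢opp (neg _) ()

atom-≡ : (l m : Literal N) → atom l ≡ atom m → l ≡ m ⊎ l ≡ opp m
atom-≡ (pos _) (pos _) refl = inj₁ refl
atom-≡ (pos _) (neg _) refl = inj₂ refl
atom-≡ (neg _) (pos _) refl = inj₂ refl
atom-≡ (neg _) (neg _) refl = inj₁ refl

holds-or-opp : (M : Subset N) (l : Literal N) → LitTrue M l ⊎ LitTrue M (opp l)
holds-or-opp M (pos a) with a ∈ˢ? M
... | yes p = inj₁ p
... | no ¬p = inj₂ ¬p
holds-or-opp M (neg a) with a ∈ˢ? M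
... | yes p = inj₂ p
... | no ¬p = inj₁ ¬p

not-both : {M : Subset N} (l : Literal N) → LitTrue M l → LitTrue M (opp l) → ⊥
not-both (pos _) p q = q p
not-both (neg _) p q = p q

Pair : ℕ → Set
Pair N = Literal N × Literal N

pairClause : Pair N → Clause N
pairClause (l , m) = l ∷ m ∷ []

Touches : Fin N → Pair N → Set
Touches a (l , m) = a ≡ atom l ⊎ a ≡ atom m

touches? : (a : Fin N) (P : Pair N) → Dec (Touches a P)
touches? a (l , m) = (a ≟ᶠ atom l) ⊎-dec (a ≟ᶠ atom m)

Disjoint : Pair N → Pair N → Set
Disjoint P Q = ∀ {a} → Touches a P → ¬ Touches a Q

Same : Pair N → Pair N → Set
Same P Q = P ≡ Q ⊎ P ≡ swap Q

Distinct : Pair N → Pair N → Set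
Distinct P Q = ¬ Same P Q

-- The theory of a state is its clauses over the free atoms; the pairs are
-- 2-clauses on pairwise disjoint sets of atoms, each of which lowers the measure.
record State (N : ℕ) : Set where
  constructor state
  field
    fixed : List (Literal N)
    free  : List (Fin N)
    pairs : List (Pair N)
    rest  : Theory N
open State public

clauses : State N → Theory N
clauses S = map pairClause (pairs S) ++ rest S

Apart : List (Literal N) → Set
Apart = AllPairs (_≢_ on atom)

record Proper (S : State N) (C : Clause N) : Set where
  constructor proper
  field
    in-free : ∀ {l} → l ∈ C → atom l ∈ free S
    apart   : Apart C
    short   : length C ≤ 3
open Proper public

record WF (S : State N) : Set where
  constructor wf
  field
    cover    : ∀ a → a ∈ free S ⊎ Any (λ l → atom l ≡ a) (fixed S)
    allProper : ∀ {C} → C ∈ clauses S → Proper S C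
    disjoint : AllPairs Disjoint (pairs S)
open WF public

Critical : Subset N → Fin N → Clause N → Set
Critical M a C = pos a ∈ C × (∀ {l} → l ∈ C → LitTrue M l → l ≡ pos a)

-- In place of minimality, which refers to all subsets of M, branching preserves
-- the existence of critical clauses.
record Good (S : State N) (M : Subset N) : Set where
  constructor good
  field
    fix  : All (LitTrue M) (fixed S)
    sat  : ∀ {C} → C ∈ clauses S → Any (LitTrue M) C
    crit : ∀ {a} → a ∈ free S → a ∈ˢ M → ∃ λ C → C ∈ clauses S × Critical M a C
open Good public

-- Some clause of S is contained in ys, so that S entails ys.
record _⊢_ (S : State N) (ys : Clause N) : Set where
  constructor by
  field
    {clause} : Clause N
    member   : clause ∈ clauses S
    within   : clause ⊆ ys
open _⊢_ public

⊢-⊆ : ∀ {S : State N} {ys zs} → ys ⊆ zs → S ⊢ ys → S ⊢ zs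
⊢-⊆ s (by D∈ D⊆) = by D∈ (s ∘ D⊆)

⊢-sat : ∀ {S : State N} {M ys} → Good S M → S ⊢ ys → Any (LitTrue M) ys
⊢-sat g (by D∈ D⊆) with find (sat g D∈)
... | l , l∈ , t = lose (D⊆ l∈) t

data Paired (S : State N) (l m : Literal N) : Set where
  fwd : (l , m) ∈ pairs S → Paired S l m
  bwd : (m , l) ∈ pairs S → Paired S l m

paired-sym : ∀ {S : State N} {l m} → Paired S l m → Paired S m l
paired-sym (fwd p) = bwd p
paired-sym (bwd p) = fwd p

pair-∈ : ∀ {S : State N} {P} → P ∈ pairs S → pairClause P ∈ clauses S
pair-∈ p = ∈-++⁺ˡ (∈-map⁺ pairClause p)

rest-∈ : ∀ {S : State N} {C} → C ∈ rest S → C ∈ clauses S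
rest-∈ {S = S} p = ∈-++⁺ʳ (map pairClause (pairs S)) p

paired-⊢ : ∀ {S : State N} {l m} → Paired S l m → S ⊢ (l ∷ m ∷ [])
paired-⊢ {S = S} (fwd p) = by (pair-∈ {S = S} p) λ x → x
paired-⊢ {S = S} (bwd p) = by (pair-∈ {S = S} p) λ { (here e) → there (here e) ; (there (here e)) → here e }

-- Assigning a literal

without : Literal N → Theory N → Theory N
without l T = map (filter (λ m → ¬? (m ≟ opp l))) (filter (λ C → ¬? (any? (l ≟_) C)) T)

-- `rest` is computed from all clauses, pairs included: a pair with `opp l` leaves `pairs`, but its
-- other literal survives in `rest` as a unit clause, and a pair without the atom is copied there.
-- Such copies are removed later by `discard`.
assign : Literal N → State N → State N
assign l S = record
  { fixed = l ∷ fixed S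
  ; free  = filter (λ b → ¬? (b ≟ᶠ atom l)) (free S)
  ; pairs = filter (λ P → ¬? (touches? (atom l) P)) (pairs S)
  ; rest  = without l (clauses S)
  }

module _ (l : Literal N) {S : State N} where

  without⁺ : ∀ {C} → C ∈ clauses S → ¬ l ∈ C → filter (λ m → ¬? (m ≟ opp l)) C ∈ rest (assign l S)
  without⁺ C∈ l∉ = ∈-map⁺ _ (∈-filter⁺ _ C∈ l∉)

  clauses-assign⁻ : ∀ {C′} → C′ ∈ clauses (assign l S) →
                    ∃ λ C → C ∈ clauses S × ((C′ ≡ C × ¬ (Any (λ m → atom l ≡ atom m) C′)) ⊎
                      (¬ l ∈ C × C′ ≡ filter (λ m → ¬? (m ≟ opp l)) C))
  clauses-assign⁻ C′∈ with ∈-++⁻ (map pairClause (pairs (assign l S))) C′∈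
  clauses-assign⁻ _ | inj₁ p with ∈-map⁻ pairClause p
  ... | P , P∈ , refl with ∈-filter⁻ _ {xs = pairs S} P∈
  ... | P∈S , ¬t = _ , pair-∈ {S = S} P∈S , inj₁ (refl , λ { (here e) → ¬t (inj₁ e) ; (there (here e)) → ¬t (inj₂ e) })
  clauses-assign⁻ _ | inj₂ p with ∈-map⁻ _ p
  ... | C , C∈ , refl with ∈-filter⁻ _ {xs = clauses S} C∈
  ... | C∈S , l∉ = C , C∈S , inj₂ (l∉ , refl)

  free-assign⁺ : ∀ {a} → a ∈ free S → a ≢ atom l → a ∈ free (assign l S)
  free-assign⁺ = ∈-filter⁺ _

  free-assign⁻ : ∀ {a} → a ∈ free (assign l S) → a ∈ free S × a ≢ atom l
  free-assign⁻ = ∈-filter⁻ _ {xs = free S}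

  pairs-assign⁻ : ∀ {P} → P ∈ pairs (assign l S) → P ∈ pairs S × ¬ Touches (atom l) P
  pairs-assign⁻ = ∈-filter⁻ _ {xs = pairs S}

  paired-assign⁻ : ∀ {m d} → Paired (assign l S) m d → Paired S m d
  paired-assign⁻ (fwd p) = fwd (proj₁ (pairs-assign⁻ p))
  paired-assign⁻ (bwd p) = bwd (proj₁ (pairs-assign⁻ p))

  -- The critical clause of another true atom cannot contain `l`, which would be a second true
  -- literal. So it is kept, and only the false literal `opp l` can be deleted from it.
  good-assign : ∀ {M} → Good S M → LitTrue M l → Good (assign l S) M
  good-assign {M} g t = good (t ∷ fix g) sat′ crit′
    where
    sat′ : ∀ {C} → C ∈ clauses (assign l S) → Any (LitTrue M) C
    sat′ C∈ with clauses-assign⁻ C∈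
    ... | C , C∈S , inj₁ (refl , _) = sat g C∈S
    ... | C , C∈S , inj₂ (_ , refl) with find (sat g C∈S)
    ... | m , m∈ , mt = lose (∈-filter⁺ _ m∈ λ e → not-both l t (subst (LitTrue M) e mt)) mt
    crit′ : ∀ {a} → a ∈ free (assign l S) → a ∈ˢ M → ∃ λ C → C ∈ clauses (assign l S) × Critical M a C
    crit′ {a} a∈ aM with free-assign⁻ a∈
    ... | a∈S , a≢ with crit g a∈S aM
    ... | C , C∈ , a∈C , only =
      _ , rest-∈ {S = assign l S} (without⁺ C∈ λ l∈ → a≢ (sym (cong atom (only l∈ t)))) ,
      ∈-filter⁺ _ a∈C (λ e → a≢ (trans (cong atom e) (atom-opp l))) ,
      λ m∈ → only (proj₁ (∈-filter⁻ _ {xs = C} m∈))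

  wf-assign : WF S → WF (assign l S)
  wf-assign w = wf cover′ proper′ (AllPairs.filter⁺ _ (disjoint w))
    where
    cover′ : ∀ a → a ∈ free (assign l S) ⊎ Any (λ m → atom m ≡ a) (l ∷ fixed S)
    cover′ a with a ≟ᶠ atom l
    ... | yes e = inj₂ (here (sym e))
    ... | no ¬e with cover w a
    ... | inj₁ a∈ = inj₁ (free-assign⁺ a∈ ¬e)
    ... | inj₂ a∈ = inj₂ (there a∈)
    proper′ : ∀ {C} → C ∈ clauses (assign l S) → Proper (assign l S) C
    proper′ C∈ with clauses-assign⁻ C∈
    ... | C , C∈S , inj₁ (refl , ¬t) = proper
      (λ m∈ → free-assign⁺ (in-free P m∈) λ e → ¬t (lose m∈ (sym e))) (apart P) (short P)
      where P = allProper w C∈S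
    ... | C , C∈S , inj₂ (l∉ , refl) = proper free′ (AllPairs.filter⁺ _ (apart P)) (≤-trans (length-filter _ C) (short P))
      where
      P = allProper w C∈S
      free′ : ∀ {m} → m ∈ filter (λ m → ¬? (m ≟ opp l)) C → atom m ∈ free (assign l S)
      free′ {m} m∈ with ∈-filter⁻ _ {xs = C} m∈
      ... | m∈C , m≢ = free-assign⁺ (in-free P m∈C) λ e →
        [ (λ { refl → l∉ m∈C }) , m≢ ]′ (atom-≡ m l e)

  ⊢-assign : ∀ {ys} → S ⊢ (opp l ∷ ys) → ¬ l ∈ ys → assign l S ⊢ ys
  ⊢-assign {ys} (by {D} D∈ D⊆) l∉ = by (rest-∈ {S = assign l S} (without⁺ D∈ l∉D)) sub
    where
    l∉D : ¬ l ∈ D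
    l∉D l∈ with D⊆ l∈
    ... | here e   = l≢opp l e
    ... | there l∈ys = l∉ l∈ys
    sub : filter (λ m → ¬? (m ≟ opp l)) D ⊆ ys
    sub m∈ with ∈-filter⁻ _ {xs = D} m∈
    ... | m∈D , m≢ with D⊆ m∈D
    ... | here e    = contradiction e m≢
    ... | there m∈y = m∈y

  free-shrinks : atom l ∈ free S → length (free (assign l S)) < length (free S)
  free-shrinks l∈ = filter-notAll _ (free S) (Any.map (λ e ¬e → ¬e (sym e)) l∈)

record Untouched (S : State N) (a : Fin N) : Set where
  constructor untouched
  field
    none : ∀ {P} → P ∈ pairs S → ¬ Touches a P
open Untouched public

private
  -- Once a pair containing `a` is met, disjointness makes the filter the identity on all later
  -- ones.
  filter-disjoint : ∀ (a : Fin N) Ps → AllPairs Disjoint Ps →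
                    length Ps ≤ suc (length (filter (λ P → ¬? (touches? a P)) Ps))
  filter-disjoint a []       _ = z≤n
  filter-disjoint a (P ∷ Ps) (d ∷ ds) with touches? a P
  ... | yes t rewrite filter-reject (λ P → ¬? (touches? a P)) {P} {Ps} (λ ¬t → ¬t t) =
    s≤s (≤-reflexive (cong length (sym (filter-all (λ P → ¬? (touches? a P)) (All.map (λ f → f t) d)))))
  ... | no ¬t rewrite filter-accept (λ P → ¬? (touches? a P)) {P} {Ps} ¬t = s≤s (filter-disjoint a Ps ds)

pairs-assign : ∀ (l : Literal N) {S} → WF S → length (pairs S) ≤ suc (length (pairs (assign l S)))
pairs-assign l {S} w = filter-disjoint (atom l) (pairs S) (disjoint w)

pairs-untouched : ∀ (l : Literal N) {S} → Untouched S (atom l) → pairs (assign l S) ≡ pairs S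
pairs-untouched l u = filter-all (λ P → ¬? (touches? (atom l) P)) (All.tabulate (none u))

AllPairs-lookup : ∀ {A : Set} {R : A → A → Set} {xs x y} → (∀ {x y} → R x y → R y x) →
                  AllPairs R xs → x ∈ xs → y ∈ xs → x ≡ y ⊎ R x y
AllPairs-lookup s (_ ∷ _) (here refl) (here refl) = inj₁ refl
AllPairs-lookup s (r ∷ _) (here refl) (there y∈)  = inj₂ (All.lookup r y∈)
AllPairs-lookup s (r ∷ _) (there x∈)  (here refl) = inj₂ (s (All.lookup r x∈))
AllPairs-lookup s (_ ∷ p) (there x∈)  (there y∈)  = AllPairs-lookup s p x∈ y∈

disjoint-sym : {P Q : Pair N} → Disjoint P Q → Disjoint Q P
disjoint-sym d q p = d p q

module _ {S : State N} (w : WF S) where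

  paired-apart : ∀ {l m} → Paired S l m → atom l ≢ atom m
  paired-apart (fwd p) with apart (allProper w (pair-∈ {S = S} p))
  ... | (a ∷ []) ∷ _ = a
  paired-apart (bwd p) with apart (allProper w (pair-∈ {S = S} p))
  ... | (a ∷ []) ∷ _ = ≢-sym a

  paired-free : ∀ {l m} → Paired S l m → atom l ∈ free S
  paired-free (fwd p) = in-free (allProper w (pair-∈ {S = S} p)) (here refl)
  paired-free (bwd p) = in-free (allProper w (pair-∈ {S = S} p)) (there (here refl))

  private
    touching : ∀ {l m} → Paired S l m → ∃ λ P → P ∈ pairs S × Touches (atom l) P × Touches (atom m) P
    touching (fwd p) = _ , p , inj₁ refl , inj₂ refl
    touching (bwd p) = _ , p , inj₂ refl , inj₁ refl

    same-pair : ∀ {a P Q} → P ∈ pairs S → Q ∈ pairs S → Touches a P → Touches a Q → P ≡ Q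
    same-pair p q t t′ with AllPairs-lookup (λ {P} {Q} → disjoint-sym {P = P} {Q}) (disjoint w) p q
    ... | inj₁ e = e
    ... | inj₂ d = contradiction t′ (d t)

  -- By disjointness `atom m` lies in no pair but the one with `l`, which disappears together with
  -- `atom l`. A partner assigned after its mate thus destroys no further pair and counts as a
  -- `miss`.
  partner-gone : ∀ {l l′ m} → Paired S l m → atom l′ ≡ atom l → Untouched (assign l′ S) (atom m)
  partner-gone {l′ = l′} pd e = untouched go
    where
    go : ∀ {Q} → Q ∈ pairs (assign l′ S) → ¬ Touches _ Q
    go Q∈ t with touching pd | pairs-assign⁻ l′ {S} Q∈
    ... | P , P∈ , tl , tm | Q∈S , ¬t with same-pair P∈ Q∈S tm t
    ... | refl = ¬t (subst (λ a → Touches a P) (sym e) tl)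

  paired-unique : ∀ {l m l′ m′} → Paired S l m → Paired S l′ m′ → atom l ≡ atom l′ → l ≡ l′ × m ≡ m′
  paired-unique {l} {m} {l′} {m′} (fwd p) (fwd q) e with same-pair p q (inj₁ refl) (inj₁ e)
  ... | refl = refl , refl
  paired-unique (fwd p) (bwd q) e with same-pair p q (inj₁ refl) (inj₂ e)
  ... | refl = contradiction e (paired-apart (fwd p))
  paired-unique (bwd p) (fwd q) e with same-pair p q (inj₂ refl) (inj₁ e)
  ... | refl = contradiction e (paired-apart (bwd p))
  paired-unique (bwd p) (bwd q) e with same-pair p q (inj₂ refl) (inj₂ e)
  ... | refl = refl , refl

touch-view : (S : State N) (y : Literal N) →
             (∃ λ d → Paired S y d) ⊎ (∃ λ d → Paired S (opp y) d) ⊎ Untouched S (atom y)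
touch-view S y with any? (touches? (atom y)) (pairs S)
... | no ¬t = inj₂ (inj₂ (untouched λ P∈ t → ¬t (lose P∈ t)))
... | yes t with find t
... | (l , m) , P∈ , inj₁ e with atom-≡ l y (sym e)
...   | inj₁ refl = inj₁ (m , fwd P∈)
...   | inj₂ refl = inj₂ (inj₁ (m , fwd P∈))
touch-view S y | yes t | (l , m) , P∈ , inj₂ e with atom-≡ m y (sym e)
...   | inj₁ refl = inj₁ (l , bwd P∈)
...   | inj₂ refl = inj₂ (inj₁ (l , bwd P∈))

-- Assigning several literals

assign* : List (Literal N) → State N → State N
assign* []       S = S
assign* (l ∷ ls) S = assign* ls (assign l S)

good-assign* : ∀ {S : State N} {M} ls → Good S M → All (LitTrue M) ls → Good (assign* ls S) M
good-assign* []       g []       = g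
good-assign* (l ∷ ls) g (t ∷ ts) = good-assign* ls (good-assign l g t) ts

wf-assign* : ∀ {S : State N} ls → WF S → WF (assign* ls S)
wf-assign* []       w = w
wf-assign* (l ∷ ls) w = wf-assign* ls (wf-assign l w)

record Fresh (S : State N) (ls : List (Literal N)) : Set where
  constructor fresh
  field
    are-free  : All (_∈ free S) (map atom ls)
    are-apart : Unique (map atom ls)
open Fresh public

fresh-cong : ∀ {S : State N} {ls ls′} → map atom ls ≡ map atom ls′ → Fresh S ls → Fresh S ls′
fresh-cong {S = S} e (fresh f a) = fresh (subst (All (_∈ free S)) e f) (subst Unique e a)

opp-first : ∀ (l : Literal N) {S ls} → Fresh S (l ∷ ls) → Fresh S (opp l ∷ ls)
opp-first l {ls = ls} = fresh-cong {ls = l ∷ ls} {opp l ∷ ls} (cong (_∷ map atom ls) (sym (atom-opp l)))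

fresh-assign : ∀ {S : State N} {l ls} → Fresh S (l ∷ ls) → Fresh (assign l S) ls
fresh-assign {S = S} {l} (fresh (_ ∷ as∈) (a ∷ u)) = fresh (go as∈ a) u
  where
  go : ∀ {as} → All (_∈ free S) as → All (atom l ≢_) as → All (_∈ free (assign l S)) as
  go []       []       = []
  go (p ∷ ps) (q ∷ qs) = free-assign⁺ l {S} p (≢-sym q) ∷ go ps qs

fresh-unassign : ∀ (l : Literal N) {S ls} → atom l ∈ free S → Fresh (assign l S) ls → Fresh S (l ∷ ls)
fresh-unassign l {S} l∈ (fresh f u) =
  fresh (l∈ ∷ All.map (λ a∈ → proj₁ (free-assign⁻ l {S} a∈)) f)
        (All.map (λ a∈ → ≢-sym (proj₂ (free-assign⁻ l {S} a∈))) f ∷ u)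

free-assign* : ∀ {S : State N} ls → Fresh S ls → length (free (assign* ls S)) + length ls ≤ length (free S)
free-assign* []       _ = ≤-reflexive (+-identityʳ _)
free-assign* {S = S} (l ∷ ls) f@(fresh (l∈ ∷ _) _) = begin
  length (free (assign* ls (assign l S))) + suc (length ls) ≡⟨ +-suc _ _ ⟩
  suc (length (free (assign* ls (assign l S))) + length ls) ≤⟨ s≤s (free-assign* ls (fresh-assign f)) ⟩
  suc (length (free (assign l S)))                          ≤⟨ free-shrinks l {S} l∈ ⟩
  length (free S)                                           ∎
  where open ≤-Reasoning

-- Drop S ls b: assigning ls in order destroys at most b pairs.
data Drop {N} (S : State N) : List (Literal N) → ℕ → Set where
  done : Drop S [] 0
  hit  : ∀ {l ls b} → Drop (assign l S) ls b → Drop S (l ∷ ls) (suc b)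
  miss : ∀ {l ls b} → Untouched S (atom l) → Drop (assign l S) ls b → Drop S (l ∷ ls) b

drop-bound : ∀ {S : State N} {ls b} → WF S → Drop S ls b → length (pairs S) ≤ length (pairs (assign* ls S)) + b
drop-bound w done = ≤-reflexive (sym (+-identityʳ _))
drop-bound {S = S} w (hit {l} {ls} {b} d) = begin
  length (pairs S)                                  ≤⟨ pairs-assign l w ⟩
  suc (length (pairs (assign l S)))                 ≤⟨ s≤s (drop-bound (wf-assign l w) d) ⟩
  suc (length (pairs (assign* ls (assign l S))) + b) ≡⟨ sym (+-suc _ b) ⟩
  length (pairs (assign* ls (assign l S))) + suc b  ∎
  where open ≤-Reasoning
drop-bound {S = S} w (miss {l} {ls} {b} u d) =
  subst (λ Ps → length Ps ≤ length (pairs (assign* ls (assign l S))) + b) (pairs-untouched l u) (drop-bound (wf-assign l w) d)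

untouched-assign : ∀ (l : Literal N) {S a} → Untouched S a → Untouched (assign l S) a
untouched-assign l {S} u = untouched λ P∈ → none u (proj₁ (pairs-assign⁻ l {S} P∈))

-- States with additional 2-clauses

Count : State N → ℕ → Set
Count S c = Card (Good S) c (length (free S)) (length (pairs S))

Under : State N → List (Literal N) → Subset N → Set
Under S ls M = Good S M × All (LitTrue M) ls

-- A branch is weighed at the measure of `S`, not of `assign* ls S`, so that the coefficients of
-- sibling branches can simply be added.
CountUnder : State N → List (Literal N) → ℕ → Set
CountUnder S ls c = Card (Under S ls) c (length (free S)) (length (pairs S))

count-under : ∀ {S : State N} c′ ls {b c} → WF S → Fresh S ls → Drop S ls b → Count (assign* ls S) c →
              Fits c (length ls) b 0 c′ →
              CountUnder S ls c′
count-under {S = S} c′ ls {b} w f d cnt check = Card-shift (length ls) b 0 (free-assign* ls f)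
  (subst (_≤ length (pairs (assign* ls S)) + b) (sym (+-identityʳ _)) (drop-bound w d)) check
  (Card-⊆ (λ { (g , ts) → good-assign* ls g ts }) cnt)

rest-holds : ∀ {S : State N} {M l ys} → Good S M → S ⊢ (l ∷ ys) → ¬ LitTrue M l → Any (LitTrue M) ys
rest-holds g e ¬l with ⊢-sat g e
... | here t  = contradiction t ¬l
... | there t = t

other-holds : ∀ {S : State N} {M l m} → Good S M → S ⊢ (l ∷ m ∷ []) → ¬ LitTrue M l → LitTrue M m
other-holds g e ¬l with rest-holds g e ¬l
... | here t = t

-- A 2-clause that holds besides the pairs. It is only required to be entailed, because a later
-- assignment may shorten the clause it stems from; `unpaired` keeps it from being credited twice.
record Link (S : State N) (P : Pair N) : Set where
  constructor link
  field
    entailed : S ⊢ pairClause P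
    new      : Fresh S (pairClause P)
    unpaired : ¬ Paired S (proj₁ P) (proj₂ P)
open Link public

module _ {S : State N} {P : Pair N} (k : Link S P) where

  link-free₁ : atom (proj₁ P) ∈ free S
  link-free₁ with are-free (new k)
  ... | a ∷ _ = a

  link-free₂ : atom (proj₂ P) ∈ free S
  link-free₂ with are-free (new k)
  ... | _ ∷ a ∷ _ = a

  link-apart : atom (proj₁ P) ≢ atom (proj₂ P)
  link-apart with are-apart (new k)
  ... | (a ∷ _) ∷ _ = a

  link-swap : Link S (swap P)
  link-swap = link (⊢-⊆ (λ { (here e) → there (here e) ; (there (here e)) → here e }) (entailed k))
    (fresh (link-free₂ ∷ link-free₁ ∷ []) ((≢-sym link-apart ∷ []) ∷ [] ∷ []))
    (λ p → unpaired k (paired-sym p))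

link-create : ∀ (l : Literal N) {S P} → S ⊢ (opp l ∷ pairClause P) → Fresh S (pairClause P) →
              ¬ Paired S (proj₁ P) (proj₂ P) → ¬ Touches (atom l) P → Link (assign l S) P
link-create l {S} {P} e (fresh (f₁ ∷ f₂ ∷ []) u) ¬p ¬t = link
  (⊢-assign l e λ { (here q) → ¬t (inj₁ (cong atom q)) ; (there (here q)) → ¬t (inj₂ (cong atom q)) })
  (fresh (free-assign⁺ l {S} f₁ (λ q → ¬t (inj₁ (sym q))) ∷ free-assign⁺ l {S} f₂ (λ q → ¬t (inj₂ (sym q))) ∷ []) u)
  (λ p → ¬p (paired-assign⁻ l p))

link-assign : ∀ (l : Literal N) {S P} → Link S P → ¬ Touches (atom l) P → Link (assign l S) P
link-assign l k = link-create l (⊢-⊆ there (entailed k)) (new k) (unpaired k)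

addPair : Pair N → State N → State N
addPair P S = record S { pairs = P ∷ pairs S }

module _ {S : State N} {P : Pair N} (k : Link S P) where

  -- An entailed clause excludes no model, and the old critical clauses are still present.
  good-addPair : ∀ {M} → Good S M → Good (addPair P S) M
  good-addPair {M} g = good (fix g) sat′ crit′
    where
    sat′ : ∀ {C} → C ∈ clauses (addPair P S) → Any (LitTrue M) C
    sat′ (here refl) = ⊢-sat g (entailed k)
    sat′ (there C∈)  = sat g C∈
    crit′ : ∀ {a} → a ∈ free S → a ∈ˢ M → ∃ λ C → C ∈ clauses (addPair P S) × Critical M a C
    crit′ a∈ aM with crit g a∈ aM
    ... | C , C∈ , c = C , there C∈ , c

  wf-addPair : WF S → Untouched S (atom (proj₁ P)) → Untouched S (atom (proj₂ P)) → WF (addPair P S)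
  wf-addPair w u₁ u₂ = wf (cover w) proper′ (All.tabulate (λ Q∈ → λ { (inj₁ refl) → none u₁ Q∈ ; (inj₂ refl) → none u₂ Q∈ }) ∷ disjoint w)
    where
    proper′ : ∀ {C} → C ∈ clauses (addPair P S) → Proper (addPair P S) C
    proper′ (here refl) = proper (λ { (here refl) → link-free₁ k ; (there (here refl)) → link-free₂ k })
      ((link-apart k ∷ []) ∷ [] ∷ []) (s≤s (s≤s z≤n))
    proper′ (there C∈) = proper (in-free p) (apart p) (short p)
      where p = allProper w C∈

  count-addPair : ∀ {c c′} → Count (addPair P S) c → Fits c 0 0 1 c′ → Count S c′
  count-addPair cnt check = Card-shift 0 0 1 (≤-reflexive (+-identityʳ _))
    (≤-reflexive (trans (+-comm _ 1) (sym (+-identityʳ _)))) check (Card-⊆ good-addPair cnt)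

  link-addPair : ∀ {Q} → Distinct P Q → Link S Q → Link (addPair P S) Q
  link-addPair {Q} ¬s (link e n ¬p) = link (by (there (member e)) (within e)) (fresh (are-free n) (are-apart n)) ¬p′
    where
    ¬p′ : ¬ Paired (addPair P S) (proj₁ Q) (proj₂ Q)
    ¬p′ (fwd (here refl)) = ¬s (inj₁ refl)
    ¬p′ (fwd (there p))   = ¬p (fwd p)
    ¬p′ (bwd (here refl)) = ¬s (inj₂ refl)
    ¬p′ (bwd (there p))   = ¬p (bwd p)

Bounded : State N → Set
Bounded S = Count S 10000

-- Coefficients of states with 0, 1, 2, … distinct 2-clauses besides the pairs.
linkWeight : ℕ → ℕ
linkWeight 0 = 10000
linkWeight 1 = 9262
linkWeight 2 = 8773
linkWeight _ = 8449

-- The ways in which a new 2-clause can lie against disjoint pairs: it contains the complement of a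
-- paired literal, or a paired literal without the partner's atom, or no atom of any pair.
data Class (S : State N) (P : Pair N) : Set where
  negative : ∀ {y z d} → Link S (y , z) → Paired S (opp y) d → Class S P
  positive : ∀ {y z d} → Same (y , z) P → Link S (y , z) → Paired S y d → atom z ≢ atom d → Class S P
  isolated : Untouched S (atom (proj₁ P)) → Untouched S (atom (proj₂ P)) → Class S P

-- `z` cannot be `d`, since the link is not a pair; so it is the complement of `d`, and read from
-- `z` the link is of the `negative` kind.
partner-clash : ∀ {S : State N} {y z d} → Link S (y , z) → Paired S y d → atom z ≡ atom d → Paired S (opp z) y
partner-clash {S = S} {y} {z} {d} k pd q with atom-≡ z d q
... | inj₁ refl = contradiction pd (unpaired k)
... | inj₂ refl = subst (λ x → Paired S x y) (sym (opp-opp d)) (paired-sym pd)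

classify : ∀ {S : State N} {P} → Link S P → Class S P
classify {S = S} {y , z} k with touch-view S y
... | inj₂ (inj₁ (d , pd)) = negative k pd
... | inj₁ (d , pd) with atom z ≟ᶠ atom d
...   | no z≢d = positive (inj₁ refl) k pd z≢d
...   | yes q  = negative (link-swap k) (partner-clash k pd q)
classify {S = S} {y , z} k | inj₂ (inj₂ u) with touch-view S z
...   | inj₂ (inj₁ (d , pd)) = negative (link-swap k) pd
...   | inj₂ (inj₂ v)        = isolated u v
...   | inj₁ (d , pd) with atom y ≟ᶠ atom d
...     | no y≢d = positive (inj₂ refl) (link-swap k) pd y≢d
...     | yes q  = negative k (partner-clash (link-swap k) pd q)

orient : ∀ {S : State N} {y P} → y ∈ pairClause P → Link S P → ∃ λ z → Link S (y , z) × Same (y , z) P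
orient (here refl)         k = _ , k , inj₁ refl
orient (there (here refl)) k = _ , link-swap k , inj₂ refl

same-join : {P Q R : Pair N} → Same P Q → Same P R → Same Q R
same-join (inj₁ refl) (inj₁ refl) = inj₁ refl
same-join (inj₁ refl) (inj₂ refl) = inj₂ refl
same-join (inj₂ refl) (inj₁ refl) = inj₂ refl
same-join (inj₂ refl) (inj₂ refl) = inj₁ refl

avoids : ∀ (y : Literal N) {P} → ¬ y ∈ pairClause P → ¬ opp y ∈ pairClause P → ¬ Touches (atom y) P
avoids y {l , m} ¬y ¬o (inj₁ q) with atom-≡ y l q
... | inj₁ refl = ¬y (here refl)
... | inj₂ refl = ¬o (here (opp-opp l))
avoids y {l , m} ¬y ¬o (inj₂ q) with atom-≡ y m q
... | inj₁ refl = ¬y (there (here refl))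
... | inj₂ refl = ¬o (there (here (opp-opp m)))

IH : ℕ → ℕ → Set
IH N b = ∀ {S : State N} → WF S → length (free S) < b → Bounded S

-- Branching on 2-clauses that meet a pair

module Step {b : ℕ} (ih : IH N b) where

  small-assign* : ∀ {S : State N} l ls → length (free S) ≤ b → Fresh S (l ∷ ls) →
                  length (free (assign* (l ∷ ls) S)) < b
  small-assign* l ls S≤ f = ≤-trans (≤-trans (s≤s (m≤m+n _ (length ls)))
    (≤-trans (≤-reflexive (sym (+-suc _ _))) (free-assign* (l ∷ ls) f))) S≤

  leaf : ∀ {S : State N} c′ l ls {d} → WF S → length (free S) ≤ b → Fresh S (l ∷ ls) → Drop S (l ∷ ls) d →
         Fits 10000 (suc (length ls)) d 0 c′ →
         CountUnder S (l ∷ ls) c′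
  leaf c′ l ls w S≤ f dr check =
    count-under c′ (l ∷ ls) w f dr (ih (wf-assign* (l ∷ ls) w) (small-assign* l ls S≤ f)) check

  module _ {S : State N} (w : WF S) (S≤ : length (free S) ≤ b) where

    leaf₁ : ∀ c′ l → atom l ∈ free S → Fits 10000 1 1 0 c′ → CountUnder S (l ∷ []) c′
    leaf₁ c′ l l∈ = leaf c′ l [] w S≤ (fresh (l∈ ∷ []) ([] ∷ [])) (hit done)

    -- Either value of `y` forces a second literal: `d` through the pair, `z` through the link.
    -- Assigning `d` is free because its pair is already gone, giving 3970 = 10⁴/(τ²x); `z` may
    -- break another pair, giving 4396 = 10⁴/(τ²x²).
    count-negative : ∀ {y z d} → Link S (y , z) → Paired S (opp y) d → Count S 8366
    count-negative {y} {z} {d} k pd = Card-⊎ split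
      (leaf 3970 y (d ∷ []) w S≤
        (fresh (link-free₁ k ∷ paired-free w (paired-sym pd) ∷ [])
          (((λ q → paired-apart w pd (trans (atom-opp y) q)) ∷ []) ∷ [] ∷ []))
        (hit (miss (partner-gone w pd (sym (atom-opp y))) done)) (fits _))
      (leaf 4396 (opp y) (z ∷ []) w S≤
        (opp-first y (new k))
        (hit (hit done)) (fits _)) _
      where
      split : ∀ {M} → Good S M → Under S (y ∷ d ∷ []) M ⊎ Under S (opp y ∷ z ∷ []) M
      split {M} g with holds-or-opp M y
      ... | inj₁ t = inj₁ (g , t ∷ other-holds g (paired-⊢ pd) (not-both y t) ∷ [])
      ... | inj₂ f = inj₂ (g , f ∷ other-holds g (entailed k) (λ t → not-both y t f) ∷ [])

    positive-fresh : ∀ {y z d} → Link S (y , z) → Paired S y d → atom z ≢ atom d → Fresh S (y ∷ d ∷ z ∷ [])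
    positive-fresh k pd z≢d = fresh (link-free₁ k ∷ paired-free w (paired-sym pd) ∷ link-free₂ k ∷ [])
      ((paired-apart w pd ∷ link-apart k ∷ []) ∷ (≢-sym z≢d ∷ []) ∷ [] ∷ [])

    -- With `y` false both `d` and `z` are forced: three atoms and at most two pairs, hence 2632 =
    -- 10⁴/(τ³x²). The count with `y` true is a parameter, because further links may be exploited
    -- there.
    count-positive : ∀ {y z d c c₂} c₁ → Link S (y , z) → Paired S y d → atom z ≢ atom d → Count (assign y S) c →
                     Fits c 1 1 0 c₁ → T (c₁ + 2632 ≤ᵇ c₂) → Count S c₂
    count-positive {y} {z} {d} c₁ k pd z≢d cnt check sum = Card-⊎ split
      (count-under c₁ (y ∷ []) w (fresh (link-free₁ k ∷ []) ([] ∷ [])) (hit done) cnt check)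
      (leaf 2632 (opp y) (d ∷ z ∷ []) w S≤
        (opp-first y (positive-fresh k pd z≢d))
        (hit (miss (partner-gone w pd (atom-opp y)) (hit done))) (fits _)) sum
      where
      split : ∀ {M} → Good S M → Under S (y ∷ []) M ⊎ Under S (opp y ∷ d ∷ z ∷ []) M
      split {M} g with holds-or-opp M y
      ... | inj₁ t = inj₁ (g , t ∷ [])
      ... | inj₂ f = inj₂ (g , f ∷ other-holds g (paired-⊢ pd) (λ t → not-both y t f)
                                 ∷ other-holds g (entailed k) (λ t → not-both y t f) ∷ [])

    -- Falsifying `y` now forces three literals, for 1745 = 10⁴/(τ⁴x³). If `z` and `z′` are
    -- complementary, `y` must be true; if `z′` lies on the atom of `d`, the link is of the
    -- `negative` kind.
    count-shared : ∀ {y z z′ d} → Link S (y , z) → Link S (y , z′) → z ≢ z′ → Paired S y d →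
                   atom z ≢ atom d → Count S 8375
    count-shared {y} {z} {z′} {d} k k′ z≢z′ pd z≢d with atom z′ ≟ᶠ atom d
    ... | yes q = Card-mono _ (count-negative (link-swap k′) (partner-clash k′ pd q))
    ... | no z′≢d with atom z ≟ᶠ atom z′
    ...   | yes q = Card-mono _ (Card-⊆ only (leaf₁ 6630 y (link-free₁ k) (fits _)))
      where
      only : ∀ {M} → Good S M → Under S (y ∷ []) M
      only {M} g with holds-or-opp M y | atom-≡ z z′ q
      ... | inj₁ t | _        = g , t ∷ []
      ... | inj₂ f | inj₁ z≡  = contradiction z≡ z≢z′
      ... | inj₂ f | inj₂ refl = ⊥-elim (not-both z′ (other-holds g (entailed k′) ¬t) (other-holds g (entailed k) ¬t))
        where ¬t = λ t → not-both y t f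
    ...   | no z≉z′ = Card-⊎ split (leaf₁ 6630 y (link-free₁ k) (fits _))
      (leaf 1745 (opp y) (d ∷ z ∷ z′ ∷ []) w S≤
        (opp-first y
          (fresh (link-free₁ k ∷ paired-free w (paired-sym pd) ∷ link-free₂ k ∷ link-free₂ k′ ∷ [])
            ((paired-apart w pd ∷ link-apart k ∷ link-apart k′ ∷ []) ∷ (≢-sym z≢d ∷ ≢-sym z′≢d ∷ [])
              ∷ (z≉z′ ∷ []) ∷ [] ∷ [])))
        (hit (miss (partner-gone w pd (atom-opp y)) (hit (hit done)))) (fits _)) _
      where
      split : ∀ {M} → Good S M → Under S (y ∷ []) M ⊎ Under S (opp y ∷ d ∷ z ∷ z′ ∷ []) M
      split {M} g with holds-or-opp M y
      ... | inj₁ t = inj₁ (g , t ∷ [])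
      ... | inj₂ f = inj₂ (g , f ∷ other-holds g (paired-⊢ pd) ¬t ∷ other-holds g (entailed k) ¬t
                                 ∷ other-holds g (entailed k′) ¬t ∷ [])
        where ¬t = λ t → not-both y t f

  private
    e-negative : ∀ j → T (8366 ≤ᵇ linkWeight (suc j))
    e-negative 0 = _
    e-negative 1 = _
    e-negative (suc (suc _)) = _

    e-shared : ∀ j → T (8375 ≤ᵇ linkWeight j)
    e-shared 0 = _
    e-shared 1 = _
    e-shared 2 = _
    e-shared (suc (suc (suc _))) = _

    e-isolated : ∀ j → Fits (linkWeight j) 0 0 1 (linkWeight (suc j))
    e-isolated 0 = fits _
    e-isolated 1 = fits _
    e-isolated 2 = fits _
    e-isolated (suc (suc (suc _))) = fits _

    e-positive : ∀ j → Fits (linkWeight j) 1 1 0 (linkWeight (suc j) ∸ 2632)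
    e-positive 0 = fits _
    e-positive 1 = fits _
    e-positive 2 = fits _
    e-positive (suc (suc (suc _))) = fits _

    e-sum : ∀ j → T ((linkWeight (suc j) ∸ 2632) + 2632 ≤ᵇ linkWeight (suc j))
    e-sum 0 = _
    e-sum 1 = _
    e-sum (suc (suc _)) = _

  -- The coefficients follow the worst case, a link `y ∨ z` meeting a pair `y ∨ d`: with `y` true
  -- one pair is lost and the other links survive, with `y` false `d` and `z` are forced. So w(j+1)
  -- = w(j)/(τx) + 1/(τ³x²), kept constant from three links on. If another link contains `opp y` or
  -- `y`, then `count-negative` or `count-shared` is below every coefficient required.
  count-links : ∀ {S : State N} → WF S → length (free S) < b → ∀ Ds → All (Link S) Ds → AllPairs Distinct Ds →
                Count S (linkWeight (length Ds))
  count-isolated : ∀ {S : State N} → WF S → length (free S) < b → ∀ {D Ds c′} → All (Link S) (D ∷ Ds) →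
                   AllPairs Distinct (D ∷ Ds) → Untouched S (atom (proj₁ D)) → Untouched S (atom (proj₂ D)) →
                   Fits (linkWeight (length Ds)) 0 0 1 c′ → Count S c′

  count-isolated w S< {D} {Ds} (k ∷ ks) (d ∷ ds) u v check =
    count-addPair k (count-links (wf-addPair k w u v) S< Ds (All.zipWith (λ { (a , b) → link-addPair k a b }) (d , ks)) ds) check

  count-links w S< []       _        _ = ih w S<
  count-links {S = S} w S< (D ∷ Ds) (k ∷ ks) (d ∷ ds) with classify k
  ... | negative k′ pd = Card-mono (e-negative (length Ds)) (count-negative w (≤-trans (n≤1+n _) S<) k′ pd)
  ... | isolated u v   = count-isolated w S< (k ∷ ks) (d ∷ ds) u v (e-isolated (length Ds))
  ... | positive {y} {z} s k′ pd z≢d with any? (λ Q → any? (opp y ≟_) (pairClause Q)) Ds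
  ...   | yes o with find o
  ...     | Q , Q∈ , o∈ with orient o∈ (All.lookup ks Q∈)
  ...       | z′ , k″ , _ = Card-mono (e-negative (length Ds)) (count-negative w (≤-trans (n≤1+n _) S<) k″
                              (subst (λ x → Paired S x _) (sym (opp-opp y)) pd))
  count-links {S = S} w S< (D ∷ Ds) (k ∷ ks) (d ∷ ds) | positive {y} {z} s k′ pd z≢d | no ¬o
    with any? (λ Q → any? (y ≟_) (pairClause Q)) Ds
  ...   | yes p with find p
  ...     | Q , Q∈ , y∈ with orient y∈ (All.lookup ks Q∈)
  ...       | z′ , k″ , s″ = Card-mono (e-shared (suc (length Ds))) (count-shared w (≤-trans (n≤1+n _) S<) k′ k″
                               (λ { refl → All.lookup d Q∈ (same-join s s″) }) pd z≢d)
  count-links {S = S} w S< (D ∷ Ds) (k ∷ ks) (d ∷ ds) | positive {y} {z} s k′ pd z≢d | no ¬o | no ¬y =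
    count-positive w (≤-trans (n≤1+n _) S<) (linkWeight (suc (length Ds)) ∸ 2632) k′ pd z≢d
      (count-links (wf-assign y w) (<-≤-trans (free-shrinks y {S} (link-free₁ k′)) (≤-trans (n≤1+n _) S<)) Ds links′ ds)
      (e-positive (length Ds)) (e-sum (length Ds))
    where
    links′ : All (Link (assign y S)) Ds
    links′ = All.tabulate λ {Q} Q∈ → link-assign y (All.lookup ks Q∈)
      (avoids y {Q} (λ p → ¬y (lose Q∈ p)) (λ p → ¬o (lose Q∈ p)))

-- Occurrences in 3-clauses

-- A 3-clause containing a pair is implied by it: falsifying its third literal creates no new
-- 2-clause, and in the role of a critical clause the pair replaces it. Only the other 3-clauses are
-- counted as occurrences.
Subsumed : State N → Clause N → Set
Subsumed S C = Any (λ P → proj₁ P ∈ C × proj₂ P ∈ C) (pairs S)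

subsumed? : (S : State N) (C : Clause N) → Dec (Subsumed S C)
subsumed? S C = any? (λ P → any? (proj₁ P ≟_) C ×-dec any? (proj₂ P ≟_) C) (pairs S)

Three : State N → Set
Three S = ∀ {C} → C ∈ rest S → length C ≡ 3

same? : (P Q : Pair N) → Dec (Same P Q)
same? P Q = ≡-dec _≟_ _≟_ P Q ⊎-dec ≡-dec _≟_ _≟_ P (swap Q)

record Occ (S : State N) (l : Literal N) (P : Pair N) : Set where
  constructor occ
  field
    {host}       : Clause N
    host-∈       : host ∈ rest S
    unsubsumed   : ¬ Subsumed S host
    l-∈          : l ∈ host
    fst-∈        : proj₁ P ∈ host
    snd-∈        : proj₂ P ∈ host
    exact        : host ⊆ l ∷ pairClause P
    apart-from   : ¬ Touches (atom l) P
    pair-fresh   : Fresh S (pairClause P)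
open Occ public

-- Links S l Ls: the unsubsumed clauses containing l are, up to order and
-- repetition, l ∨ u ∨ v for (u , v) in Ls.
record Links (S : State N) (l : Literal N) (Ls : List (Pair N)) : Set where
  constructor links
  field
    occs     : All (Occ S l) Ls
    distinct : AllPairs Distinct Ls
    complete : ∀ {C} → C ∈ rest S → l ∈ C → ¬ Subsumed S C → Any (λ P → proj₁ P ∈ C × proj₂ P ∈ C) Ls
open Links public

private
  rest-of-three : ∀ {C : Clause N} {l} → length C ≡ 3 → Apart C → l ∈ C →
    ∃ λ P → proj₁ P ∈ C × proj₂ P ∈ C × C ⊆ l ∷ pairClause P × ¬ Touches (atom l) P × atom (proj₁ P) ≢ atom (proj₂ P)
  rest-of-three {C = x ∷ y ∷ z ∷ []} _ ((xy ∷ xz ∷ []) ∷ (yz ∷ []) ∷ [] ∷ []) (here refl) =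
    (y , z) , there (here refl) , there (there (here refl)) , (λ p → p) , (λ { (inj₁ q) → xy q ; (inj₂ q) → xz q }) , yz
  rest-of-three {C = x ∷ y ∷ z ∷ []} _ ((xy ∷ xz ∷ []) ∷ (yz ∷ []) ∷ [] ∷ []) (there (here refl)) =
    (x , z) , here refl , there (there (here refl)) ,
    (λ { (here q) → there (here q) ; (there (here q)) → here q ; (there (there q)) → there (there q) }) ,
    (λ { (inj₁ q) → xy (sym q) ; (inj₂ q) → yz q }) , xz
  rest-of-three {C = x ∷ y ∷ z ∷ []} _ ((xy ∷ xz ∷ []) ∷ (yz ∷ []) ∷ [] ∷ []) (there (there (here refl))) =
    (x , y) , here refl , there (here refl) ,
    (λ { (here q) → there (here q) ; (there (here q)) → there (there (here q)) ; (there (there (here q))) → here q }) ,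
    (λ { (inj₁ q) → xz (sym q) ; (inj₂ q) → yz (sym q) }) , xy

find-links : ∀ {S : State N} → WF S → Three S → ∀ l → ∃ (Links S l)
find-links {S = S} w three l with go (rest S) (λ p → p)
  where
  go : ∀ T → T ⊆ rest S → ∃ λ Ls → All (Occ S l) Ls × AllPairs Distinct Ls ×
         (∀ {C} → C ∈ T → l ∈ C → ¬ Subsumed S C → Any (λ P → proj₁ P ∈ C × proj₂ P ∈ C) Ls)
  go []      _   = [] , [] , [] , λ ()
  go (C ∷ T) sub with go T (sub ∘ there) | any? (l ≟_) C | subsumed? S C
  ... | Ls , os , ds , cov | no l∉ | _ =
    Ls , os , ds , λ { (here refl) l∈ _ → contradiction l∈ l∉ ; (there C∈) → cov C∈ }
  ... | Ls , os , ds , cov | yes _ | yes s =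
    Ls , os , ds , λ { (here refl) _ ¬s → contradiction s ¬s ; (there C∈) → cov C∈ }
  ... | Ls , os , ds , cov | yes l∈ | no ¬s
    with allProper w (rest-∈ {S = S} (sub (here refl)))
  ... | prop with rest-of-three (three (sub (here refl))) (apart prop) l∈
  ... | P , P₁∈ , P₂∈ , ex , ¬t , u≢v with any? (same? P) Ls
  ... | yes s = Ls , os , ds , λ { (here refl) _ _ → Any.map (λ { (inj₁ refl) → P₁∈ , P₂∈ ; (inj₂ refl) → P₂∈ , P₁∈ }) s
                                 ; (there C∈) → cov C∈ }
  ... | no ¬s′ = P ∷ Ls ,
    occ (sub (here refl)) ¬s l∈ P₁∈ P₂∈ ex ¬t (fresh (in-free prop P₁∈ ∷ in-free prop P₂∈ ∷ []) ((u≢v ∷ []) ∷ [] ∷ [])) ∷ os ,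
    All.tabulate (λ Q∈ s → ¬s′ (lose Q∈ s)) ∷ ds ,
    λ { (here refl) _ _ → here (P₁∈ , P₂∈) ; (there C∈) l∈ ¬s → there (cov C∈ l∈ ¬s) }
... | Ls , os , ds , cov = Ls , links os ds cov

module _ {S : State N} {l : Literal N} {P : Pair N} (o : Occ S l P) where

  occ-⊢ : S ⊢ (l ∷ pairClause P)
  occ-⊢ = by (rest-∈ {S = S} (host-∈ o)) (exact o)

  not-in-host : ∀ {x y} → Paired S x y → x ∈ host o → ¬ y ∈ host o
  not-in-host (fwd p) x∈ y∈ = unsubsumed o (lose p (x∈ , y∈))
  not-in-host (bwd p) x∈ y∈ = unsubsumed o (lose p (y∈ , x∈))

  occ-swap : Occ S l (swap P)
  occ-swap = occ (host-∈ o) (unsubsumed o) (l-∈ o) (snd-∈ o) (fst-∈ o)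
    (λ x → perm (exact o x)) (λ { (inj₁ q) → apart-from o (inj₂ q) ; (inj₂ q) → apart-from o (inj₁ q) })
    (flip (pair-fresh o))
    where
    perm : l ∷ pairClause P ⊆ l ∷ pairClause (swap P)
    perm (here q) = here q
    perm (there (here q)) = there (there (here q))
    perm (there (there (here q))) = there (here q)
    flip : Fresh S (pairClause P) → Fresh S (pairClause (swap P))
    flip (fresh (a ∷ b ∷ []) ((c ∷ []) ∷ [] ∷ [])) = fresh (b ∷ a ∷ []) ((≢-sym c ∷ []) ∷ [] ∷ [])

-- Falsifying a literal of a 3-clause leaves a 2-clause; that it differs from all pairs is exactly
-- what being unsubsumed provides.
occ-link : ∀ (l : Literal N) {S P} → Occ S (opp l) P → Link (assign l S) P
occ-link l {P = P} o = link-create l (occ-⊢ o) (pair-fresh o) (λ p → not-in-host o p (fst-∈ o) (snd-∈ o))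
  (λ t → apart-from o (subst (λ a → Touches a P) (sym (atom-opp l)) t))

occ-link′ : ∀ (l : Literal N) {S P} → Occ S l P → Link (assign (opp l) S) P
occ-link′ l {S} {P} o = occ-link (opp l) (subst (λ x → Occ S x P) (sym (opp-opp l)) o)

false⇒opp : ∀ (M : Subset N) l → ¬ LitTrue M l → LitTrue M (opp l)
false⇒opp M l ¬t with holds-or-opp M l
... | inj₁ t = contradiction t ¬t
... | inj₂ f = f

Falsified : Subset N → Pair N → Set
Falsified M P = LitTrue M (opp (proj₁ P)) × LitTrue M (opp (proj₂ P))

-- If the critical clause of `a` contains a pair, the true literal of that pair must be `pos a`, so
-- the partner is false. Otherwise the clause is an unsubsumed one, hence listed in `Ls`, and its
-- two other literals are false.
support : ∀ {S : State N} {M a Ls} → WF S → Good S M → Links S (pos a) Ls → a ∈ free S → a ∈ˢ M →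
          (∃ λ m → Paired S (pos a) m × LitTrue M (opp m)) ⊎ Any (Falsified M) Ls
support {S = S} {M} {a} {Ls} w g ls a∈ aM with crit g a∈ aM
... | C , C∈ , a∈C , only with subsumed? S C
...   | yes s with find s
...     | P , P∈ , P₁∈ , P₂∈ = inj₁ (in-pair (sat g (pair-∈ {S = S} P∈)))
  where
  in-pair : Any (LitTrue M) (pairClause P) → ∃ λ m → Paired S (pos a) m × LitTrue M (opp m)
  in-pair (here t) with only P₁∈ t
  ... | refl = _ , fwd P∈ , false⇒opp M _ λ t′ → paired-apart w (fwd P∈) (cong atom (sym (only P₂∈ t′)))
  in-pair (there (here t)) with only P₂∈ t
  ... | refl = _ , bwd P∈ , false⇒opp M _ λ t′ → paired-apart w (bwd P∈) (cong atom (sym (only P₁∈ t′)))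
support {S = S} {M} {a} {Ls} w g ls a∈ aM | C , C∈ , a∈C , only | no ¬s
  with ∈-++⁻ (map pairClause (pairs S)) C∈
...   | inj₁ p with ∈-map⁻ pairClause p
...     | P , P∈ , refl = contradiction (lose P∈ (here refl , there (here refl))) ¬s
support {S = S} {M} {a} {Ls} w g ls a∈ aM | C , C∈ , a∈C , only | no ¬s | inj₂ C∈r =
  inj₂ (falsify (occs ls) (complete ls C∈r a∈C ¬s))
  where
  falsify : ∀ {Ls} → All (Occ S (pos a)) Ls → Any (λ P → proj₁ P ∈ C × proj₂ P ∈ C) Ls → Any (Falsified M) Ls
  falsify (o ∷ _) (here (P₁∈ , P₂∈)) = here
    ( false⇒opp M _ (λ t → apart-from o (inj₁ (cong atom (sym (only P₁∈ t)))))
    , false⇒opp M _ (λ t → apart-from o (inj₂ (cong atom (sym (only P₂∈ t))))))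
  falsify (_ ∷ os) (there p) = there (falsify os p)

-- States with a pair

falsified-same : ∀ {M : Subset N} {P Q} → Same P Q → Falsified M Q → Falsified M P
falsified-same (inj₁ refl) f         = f
falsified-same (inj₂ refl) (f₁ , f₂) = f₂ , f₁

module WithPair {b : ℕ} (ih : IH N b) {S : State N} (w : WF S) (S≤ : length (free S) ≤ b) where
  open Step ih

  pair-fresh-opp : ∀ {l m} → Paired S l m → Fresh S (opp l ∷ m ∷ [])
  pair-fresh-opp {l} pd = opp-first l (fresh (paired-free w pd ∷ paired-free w (paired-sym pd) ∷ [])
    ((paired-apart w pd ∷ []) ∷ [] ∷ []))

  pair-drop : ∀ {l m} → Paired S l m → Drop S (opp l ∷ m ∷ []) 1
  pair-drop {l} pd = hit (miss (partner-gone w pd (atom-opp l)) done)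

  pair-split : ∀ {l m} → Paired S l m → ∀ {M} → Good S M → LitTrue M l ⊎ Under S (opp l ∷ m ∷ []) M
  pair-split {l} pd {M} g with holds-or-opp M l
  ... | inj₁ t = inj₁ t
  ... | inj₂ f = inj₂ (g , f ∷ other-holds g (paired-⊢ pd) (λ t → not-both l t f) ∷ [])

  under-links : ∀ {l Qs c} → atom l ∈ free S → All (Occ S (opp l)) Qs → AllPairs Distinct Qs →
                Fits (linkWeight (length Qs)) 1 1 0 c → CountUnder S (l ∷ []) c
  under-links {l} {Qs} {c} l∈ os ds check = count-under c (l ∷ []) w f (hit done)
    (count-links (wf-assign l w) (small-assign* l [] S≤ f) Qs (All.map (occ-link l) os) ds) check
    where f = fresh (l∈ ∷ []) ([] ∷ [])

  module _ {l m : Literal N} (pd : Paired S l m) where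

    private
      S₂ : State N
      S₂ = assign* (opp l ∷ m ∷ []) S

      pair-links : ∀ {Ps} → All (Occ S l) Ps → All (λ P → ¬ Touches (atom m) P) Ps → All (Link S₂) Ps
      pair-links []       []       = []
      pair-links (o ∷ os) (n ∷ ns) = link-assign m (occ-link′ l o) n ∷ pair-links os ns

      small₂ : length (free S₂) < b
      small₂ = small-assign* (opp l) (m ∷ []) S≤ (pair-fresh-opp pd)

    under-pair : ∀ {c c′} → Count S₂ c → Fits c 2 1 0 c′ → CountUnder S (opp l ∷ m ∷ []) c′
    under-pair {c} {c′} = count-under c′ (opp l ∷ m ∷ []) w (pair-fresh-opp pd) (pair-drop pd)

    under-pair-links : ∀ {Ps c} → All (Occ S l) Ps → All (λ P → ¬ Touches (atom m) P) Ps → AllPairs Distinct Ps →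
                       Fits (linkWeight (length Ps)) 2 1 0 c → CountUnder S (opp l ∷ m ∷ []) c
    under-pair-links {Ps} os ns ds = under-pair (count-links (wf-assign* (opp l ∷ m ∷ []) w) small₂ Ps (pair-links os ns) ds)

    private
      -- An unsubsumed clause with `l` cannot contain `m`, so it contains `opp m`. With `l` false
      -- and `m` true its last literal is forced: three atoms, two pairs.
      touching-first : ∀ {P} → Occ S l P → atom m ≡ atom (proj₁ P) → CountUnder S (opp l ∷ m ∷ []) 2632
      touching-first {u , v} o q with atom-≡ m u q
      ... | inj₁ refl = contradiction (fst-∈ o) (not-in-host o pd (l-∈ o))
      ... | inj₂ refl = Card-⊆ more (leaf 2632 (opp l) (opp u ∷ v ∷ []) w S≤
        (opp-first l (fresh (paired-free w pd ∷ paired-free w (paired-sym pd) ∷ v∈ ∷ [])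
          ((paired-apart w pd ∷ (λ q → apart-from o (inj₂ q)) ∷ []) ∷ ((λ q → u≢v (trans (sym (atom-opp u)) q)) ∷ []) ∷ [] ∷ [])))
        (hit (miss (partner-gone w pd (atom-opp l)) (hit done))) (fits _))
        where
        u≢v : atom u ≢ atom v
        u≢v with are-apart (pair-fresh o)
        ... | (a ∷ _) ∷ _ = a
        v∈ : atom v ∈ free S
        v∈ with are-free (pair-fresh o)
        ... | _ ∷ a ∷ _ = a
        more : ∀ {M} → Under S (opp l ∷ opp u ∷ []) M → Under S (opp l ∷ opp u ∷ v ∷ []) M
        more (g , f ∷ f′ ∷ []) with rest-holds g (occ-⊢ o) (λ t → not-both l t f)
        ... | here t         = ⊥-elim (not-both u t f′)
        ... | there (here t) = g , f ∷ f′ ∷ t ∷ []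

    under-pair-touching : ∀ {P} → Occ S l P → Touches (atom m) P → CountUnder S (opp l ∷ m ∷ []) 2632
    under-pair-touching o (inj₁ q) = touching-first o q
    under-pair-touching o (inj₂ q) = touching-first (occ-swap o) q

    under-pair-one : ∀ {P} → Occ S l P → CountUnder S (opp l ∷ m ∷ []) 3677
    under-pair-one {P} o with touches? (atom m) P
    ... | yes t = Card-mono _ (under-pair-touching o t)
    ... | no ¬t = under-pair-links (o ∷ []) (¬t ∷ []) ([] ∷ []) (fits _)

    -- Both signs of `l` occur, so each branch gains a link: 6141 = 9262/(τx) and 3677 = 9262/(τ²x),
    -- rounded up.
    bounded-both : ∀ {P Q} → Occ S l P → Occ S (opp l) Q → Bounded S
    bounded-both o o′ = Card-⊎ split (under-links {c = 6141} (paired-free w pd) (o′ ∷ []) ([] ∷ []) (fits _)) (under-pair-one o) _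
      where
      split : ∀ {M} → Good S M → Under S (l ∷ []) M ⊎ Under S (opp l ∷ m ∷ []) M
      split g with pair-split pd g
      ... | inj₁ t = inj₁ (g , t ∷ [])
      ... | inj₂ u = inj₂ u

  only-partner : ∀ {a m M} → Paired S (pos a) m → (∃ λ m′ → Paired S (pos a) m′ × LitTrue M (opp m′)) → LitTrue M (opp m)
  only-partner pd (m′ , pd′ , f) with paired-unique w pd pd′ refl
  ... | _ , refl = f

  no-partner : ∀ {a m m′} → Paired S (neg a) m → ¬ Paired S (pos a) m′
  no-partner pd pd′ with paired-unique w pd pd′ refl
  ... | () , _

  module PositiveLiteral {a m} (pd : Paired S (pos a) m) where

    pair-fresh-pos : Fresh S (pos a ∷ opp m ∷ [])
    pair-fresh-pos = fresh-cong {ls = neg a ∷ m ∷ []} {pos a ∷ opp m ∷ []} (cong (λ x → a ∷ x ∷ []) (sym (atom-opp m))) (pair-fresh-opp pd)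

    partner-false : CountUnder S (pos a ∷ opp m ∷ []) 3970
    partner-false = leaf 3970 (pos a) (opp m ∷ []) w S≤ pair-fresh-pos
      (hit (miss (subst (Untouched _) (sym (atom-opp m)) (partner-gone w {l′ = pos a} pd refl)) done)) (fits _)

    critical : ∀ {Ls M} → Links S (pos a) Ls → Good S M → a ∈ˢ M → LitTrue M (opp m) ⊎ Any (Falsified M) Ls
    critical ls g t with support w g ls (paired-free w pd) t
    ... | inj₁ p = inj₁ (only-partner pd p)
    ... | inj₂ f = inj₂ f

    -- Only the pair can be critical for `a`, so exactly one of `pos a` and `m` holds, and both
    -- branches assign two atoms.
    bounded-none : Links S (pos a) [] → Bounded S
    bounded-none ls = Card-⊎ split partner-false
      (leaf 3970 (neg a) (m ∷ []) w S≤ (pair-fresh-opp pd) (pair-drop pd) (fits _)) _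
      where
      split : ∀ {M} → Good S M → Under S (pos a ∷ opp m ∷ []) M ⊎ Under S (neg a ∷ m ∷ []) M
      split g with pair-split pd g
      ... | inj₂ u = inj₂ u
      ... | inj₁ t with critical ls g t
      ...   | inj₁ f = inj₁ (g , t ∷ f ∷ [])

    -- For `a` true, either `m` is false or the one remaining clause is critical and falsifies `u`
    -- and `v`. In the latter case `m` may be taken true, the other value being covered already,
    -- which assigns a fourth atom unless the atom of `m` is among those of `u` and `v`.
    bounded-one : ∀ {P} → Links S (pos a) (P ∷ []) → Bounded S
    bounded-one {u , v} ls with occs ls
    ... | o ∷ [] with touches? (atom m) (u , v) | pair-fresh o
    ...   | yes t | fresh (u∈ ∷ v∈ ∷ []) ((u≢v ∷ []) ∷ [] ∷ []) = Card-⊎ split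
        (Card-+ partner-false
          (leaf 2632 (pos a) (opp u ∷ opp v ∷ []) w S≤
            (fresh-cong {ls = pos a ∷ u ∷ v ∷ []} {pos a ∷ opp u ∷ opp v ∷ []}
              (cong₂ (λ x y → a ∷ x ∷ y ∷ []) (sym (atom-opp u)) (sym (atom-opp v)))
              (fresh (paired-free w pd ∷ u∈ ∷ v∈ ∷ [])
                (((λ q → apart-from o (inj₁ q)) ∷ (λ q → apart-from o (inj₂ q)) ∷ []) ∷ (u≢v ∷ []) ∷ [] ∷ [])))
            (drops t) (fits _)))
        (under-pair-touching pd o t) _
      where
      gone : Untouched (assign (pos a) S) (atom m)
      gone = partner-gone w {l′ = pos a} pd refl
      drops : Touches (atom m) (u , v) → Drop S (pos a ∷ opp u ∷ opp v ∷ []) 2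
      drops (inj₁ q) = hit (miss (subst (Untouched _) (trans q (sym (atom-opp u))) gone) (hit done))
      drops (inj₂ q) = hit (hit (miss (untouched-assign (opp u) (subst (Untouched _) (trans q (sym (atom-opp v))) gone)) done))
      split : ∀ {M} → Good S M → (Under S (pos a ∷ opp m ∷ []) M ⊎ Under S (pos a ∷ opp u ∷ opp v ∷ []) M)
                                 ⊎ Under S (neg a ∷ m ∷ []) M
      split g with pair-split pd g
      ... | inj₂ x = inj₂ x
      ... | inj₁ t with critical ls g t
      ...   | inj₁ f = inj₁ (inj₁ (g , t ∷ f ∷ []))
      ...   | inj₂ (here (f , f′)) = inj₁ (inj₂ (g , t ∷ f ∷ f′ ∷ []))
    bounded-one {u , v} ls | o ∷ [] | no ¬t | fresh (u∈ ∷ v∈ ∷ []) ((u≢v ∷ []) ∷ [] ∷ []) = Card-⊎ split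
        (Card-+ partner-false
          (leaf 1745 (pos a) (m ∷ opp u ∷ opp v ∷ []) w S≤
            (fresh-cong {ls = pos a ∷ m ∷ u ∷ v ∷ []} {pos a ∷ m ∷ opp u ∷ opp v ∷ []}
              (cong₂ (λ x y → a ∷ atom m ∷ x ∷ y ∷ []) (sym (atom-opp u)) (sym (atom-opp v)))
              (fresh (paired-free w pd ∷ paired-free w (paired-sym pd) ∷ u∈ ∷ v∈ ∷ [])
                ((paired-apart w pd ∷ (λ q → apart-from o (inj₁ q)) ∷ (λ q → apart-from o (inj₂ q)) ∷ [])
                  ∷ ((λ q → ¬t (inj₁ q)) ∷ (λ q → ¬t (inj₂ q)) ∷ []) ∷ (u≢v ∷ []) ∷ [] ∷ [])))
            (hit (miss (partner-gone w {l′ = pos a} pd refl) (hit (hit done)))) (fits _)))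
        (under-pair-links pd {c = 3677} (o ∷ []) (¬t ∷ []) ([] ∷ []) (fits _)) _
      where
      split : ∀ {M} → Good S M → (Under S (pos a ∷ opp m ∷ []) M ⊎ Under S (pos a ∷ m ∷ opp u ∷ opp v ∷ []) M)
                                 ⊎ Under S (neg a ∷ m ∷ []) M
      split {M} g with pair-split pd g
      ... | inj₂ x = inj₂ x
      ... | inj₁ t with holds-or-opp M m | critical ls g t
      ...   | inj₂ f | _                    = inj₁ (inj₁ (g , t ∷ f ∷ []))
      ...   | inj₁ p | inj₁ f               = inj₁ (inj₁ (g , t ∷ f ∷ []))
      ...   | inj₁ p | inj₂ (here (f , f′)) = inj₁ (inj₂ (g , t ∷ p ∷ f ∷ f′ ∷ []))

    module _ (pure : Links S (opp m) []) where

      -- A clause with `pos a` and `m` would be subsumed by the pair, and one with `opp m` is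
      -- excluded by `pure`.
      untouched-by-partner : ∀ {P} → Occ S (pos a) P → ¬ Touches (atom m) P
      untouched-by-partner {P} o t with excluded t
        where
        excluded : Touches (atom m) P → opp m ∈ host o
        excluded (inj₁ q) with atom-≡ m (proj₁ P) q
        ... | inj₁ refl = contradiction (fst-∈ o) (not-in-host o pd (l-∈ o))
        ... | inj₂ refl = subst (_∈ host o) (sym (opp-opp (proj₁ P))) (fst-∈ o)
        excluded (inj₂ q) with atom-≡ m (proj₂ P) q
        ... | inj₁ refl = contradiction (snd-∈ o) (not-in-host o pd (l-∈ o))
        ... | inj₂ refl = subst (_∈ host o) (sym (opp-opp (proj₂ P))) (snd-∈ o)
      ... | m∈ with complete pure (host-∈ o) m∈ (unsubsumed o)
      ... | ()

      private
        S₂ : State N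
        S₂ = assign* (neg a ∷ m ∷ []) S

        w₂ : WF S₂
        w₂ = wf-assign* (neg a ∷ m ∷ []) w

        small₂ : length (free S₂) < b
        small₂ = small-assign* (neg a) (m ∷ []) S≤ (pair-fresh-opp pd)

        link₂ : ∀ {P} → Occ S (pos a) P → Link S₂ P
        link₂ o = link-assign m (occ-link′ (pos a) o) (untouched-by-partner o)

        plain-split : ∀ {M} → Good S M → Under S (pos a ∷ []) M ⊎ Under S (neg a ∷ m ∷ []) M
        plain-split g with pair-split pd g
        ... | inj₁ t = inj₁ (g , t ∷ [])
        ... | inj₂ u = inj₂ u

        paired₂ : ∀ {x y} → Paired S₂ x y → Paired S x y
        paired₂ p = paired-assign⁻ (neg a) (paired-assign⁻ m p)

      -- The tight case with a pair: 6630 for `a` true, and 8449/(τ²x) < 3355 for `a` false with its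
      -- three surviving links.
      bounded-three : ∀ {P Q R Ls} → Links S (pos a) (P ∷ Q ∷ R ∷ Ls) → Bounded S
      bounded-three ls with occs ls | distinct ls
      ... | o₁ ∷ o₂ ∷ o₃ ∷ _ | (d₁₂ ∷ d₁₃ ∷ _) ∷ (d₂₃ ∷ _) ∷ _ = Card-⊎ plain-split
        (leaf₁ w S≤ 6630 (pos a) (paired-free w pd) (fits _))
        (under-pair-links pd {c = 3355} (o₁ ∷ o₂ ∷ o₃ ∷ [])
          (untouched-by-partner o₁ ∷ untouched-by-partner o₂ ∷ untouched-by-partner o₃ ∷ [])
          ((d₁₂ ∷ d₁₃ ∷ []) ∷ (d₂₃ ∷ []) ∷ [] ∷ []) (fits _)) _

      private
        bounded-if : Count S₂ 8366 → Bounded S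
        bounded-if cnt = Card-⊎ plain-split (leaf₁ w S≤ 6630 (pos a) (paired-free w pd) (fits _))
          (under-pair pd {c′ = 3322} cnt (fits _)) _

        -- If y ∨ z meets the pair y ∨ d, falsifying it forces d as well.
        crossing : ∀ {y z d} → Link S₂ (y , z) → Paired S₂ y d → atom z ≢ atom d →
                   CountUnder S (pos a ∷ m ∷ opp y ∷ d ∷ opp z ∷ []) 1045
        crossing {y} {z} {d} k p z≢d = leaf 1045 (pos a) (m ∷ opp y ∷ d ∷ opp z ∷ []) w S≤
          (fresh-cong {ls = neg a ∷ m ∷ y ∷ d ∷ z ∷ []} {pos a ∷ m ∷ opp y ∷ d ∷ opp z ∷ []}
            (cong₂ (λ x x′ → a ∷ atom m ∷ x ∷ atom d ∷ x′ ∷ []) (sym (atom-opp y)) (sym (atom-opp z)))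
            (fresh-unassign (neg a) (paired-free w pd)
              (fresh-unassign m (free-assign⁺ (neg a) {S} (paired-free w (paired-sym pd)) (≢-sym (paired-apart w pd)))
                (positive-fresh w₂ (≤-trans (n≤1+n _) small₂) k p z≢d))))
          (hit (miss (partner-gone w {l′ = pos a} pd refl)
            (hit (miss (partner-gone (wf-assign* (pos a ∷ m ∷ []) w) (repair p) (atom-opp y)) (hit done)))))
          (fits _)
          where
          -- The list `pairs` depends only on which atoms are assigned, so it is the same after
          -- `pos a` as after `neg a`.
          repair : ∀ {x y} → Paired S₂ x y → Paired (assign* (pos a ∷ m ∷ []) S) x y
          repair (fwd q) = fwd q
          repair (bwd q) = bwd q

        crossing-sat : ∀ {P y z d M} → Good S M → a ∈ˢ M → LitTrue M m → Same (y , z) P → Paired S₂ y d →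
                       Falsified M P → Under S (pos a ∷ m ∷ opp y ∷ d ∷ opp z ∷ []) M
        crossing-sat {y = y} {z} {d} {M} g t t′ s p f = g , t ∷ t′ ∷ proj₁ f′ ∷ d-true ∷ proj₂ f′ ∷ []
          where
          f′ = falsified-same s f
          d-true = other-holds g (paired-⊢ (paired₂ p)) (λ t → not-both y t (proj₁ f′))

      -- The plain branching fails here: 6630 + 3483 exceeds 10000. If a link of `S₂` is isolated or
      -- `negative`, the count of `S₂` drops to 8366 and suffices. Otherwise both links are
      -- positive, and the branch `a` true is refined by the critical clause of `a`: falsifying
      -- either clause also forces `d`, so five atoms are assigned for 1045 = 10⁴/(τ⁵x³).
      bounded-two : ∀ {P Q} → Links S (pos a) (P ∷ Q ∷ []) → Bounded S
      bounded-two {P} {Q} ls with occs ls | distinct ls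
      ... | o₁ ∷ o₂ ∷ [] | (d₁₂ ∷ []) ∷ [] ∷ [] with classify (link₂ o₁) | classify (link₂ o₂)
      ...   | isolated u v   | _ = bounded-if (count-isolated w₂ small₂ (link₂ o₁ ∷ link₂ o₂ ∷ []) ((d₁₂ ∷ []) ∷ [] ∷ []) u v (fits _))
      ...   | negative k p   | _ = bounded-if (count-negative w₂ (≤-trans (n≤1+n _) small₂) k p)
      ...   | positive _ _ _ _ | isolated u v = bounded-if (count-isolated w₂ small₂ (link₂ o₂ ∷ link₂ o₁ ∷ [])
                (((λ { (inj₁ refl) → d₁₂ (inj₁ refl) ; (inj₂ refl) → d₁₂ (inj₂ refl) }) ∷ []) ∷ [] ∷ []) u v (fits _))
      ...   | positive _ _ _ _ | negative k p = bounded-if (count-negative w₂ (≤-trans (n≤1+n _) small₂) k p)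
      ...   | positive {y} {z} {d} s k p z≢d | positive {y′} {z′} {d′} s′ k′ p′ z≢d′ = Card-⊎ split
        (Card-+ partner-false (Card-+ (crossing k p z≢d) (crossing k′ p′ z≢d′)))
        (under-pair-links pd {c = 3483} (o₁ ∷ o₂ ∷ []) (untouched-by-partner o₁ ∷ untouched-by-partner o₂ ∷ [])
          ((d₁₂ ∷ []) ∷ [] ∷ []) (fits _)) _
        where
        split : ∀ {M} → Good S M → (Under S (pos a ∷ opp m ∷ []) M ⊎
                  (Under S (pos a ∷ m ∷ opp y ∷ d ∷ opp z ∷ []) M ⊎ Under S (pos a ∷ m ∷ opp y′ ∷ d′ ∷ opp z′ ∷ []) M))
                ⊎ Under S (neg a ∷ m ∷ []) M
        split {M} g with pair-split pd g
        ... | inj₂ x = inj₂ x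
        ... | inj₁ t with holds-or-opp M m | critical ls g t
        ...   | inj₂ f | _                        = inj₁ (inj₁ (g , t ∷ f ∷ []))
        ...   | inj₁ _ | inj₁ f                   = inj₁ (inj₁ (g , t ∷ f ∷ []))
        ...   | inj₁ q | inj₂ (here f)            = inj₁ (inj₂ (inj₁ (crossing-sat g t q s p f)))
        ...   | inj₁ q | inj₂ (there (here f))    = inj₁ (inj₂ (inj₂ (crossing-sat g t q s′ p′ f)))

  module NegativeLiteral {a m} (pd : Paired S (neg a) m) where

    -- The only pair on the atom `a` contains `neg a` and cannot be critical for it, so the critical
    -- clause is a 3-clause.
    critical : ∀ {Ls M} → Links S (pos a) Ls → Good S M → a ∈ˢ M → Any (Falsified M) Ls
    critical ls g t with support w g ls (paired-free w pd) t
    ... | inj₁ (_ , pd′ , _) = contradiction pd′ (no-partner pd)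
    ... | inj₂ f = f

    bounded-none : Links S (pos a) [] → Bounded S
    bounded-none ls = Card-mono _ (Card-⊆ only (leaf₁ w S≤ 6630 (neg a) (paired-free w pd) (fits _)))
      where
      only : ∀ {M} → Good S M → Under S (neg a ∷ []) M
      only {M} g with holds-or-opp M (pos a)
      ... | inj₂ f = g , f ∷ []
      ... | inj₁ t with critical ls g t
      ...   | ()

    bounded-one : ∀ {P} → Links S (pos a) (P ∷ []) → Bounded S
    bounded-one {u , v} ls with occs ls
    ... | o ∷ [] with pair-fresh o
    ... | fresh (u∈ ∷ v∈ ∷ []) ((u≢v ∷ []) ∷ [] ∷ []) = Card-⊎ split
        (leaf 2914 (pos a) (opp u ∷ opp v ∷ []) w S≤
          (fresh-cong {ls = pos a ∷ u ∷ v ∷ []} {pos a ∷ opp u ∷ opp v ∷ []}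
            (cong₂ (λ x y → a ∷ x ∷ y ∷ []) (sym (atom-opp u)) (sym (atom-opp v)))
            (fresh (paired-free w pd ∷ u∈ ∷ v∈ ∷ [])
              (((λ q → apart-from o (inj₁ q)) ∷ (λ q → apart-from o (inj₂ q)) ∷ []) ∷ (u≢v ∷ []) ∷ [] ∷ [])))
          (hit (hit (hit done))) (fits _))
        (under-links {c = 6141} (paired-free w pd) (o ∷ []) ([] ∷ []) (fits _)) _
      where
      split : ∀ {M} → Good S M → Under S (pos a ∷ opp u ∷ opp v ∷ []) M ⊎ Under S (neg a ∷ []) M
      split {M} g with holds-or-opp M (pos a)
      ... | inj₂ f = inj₂ (g , f ∷ [])
      ... | inj₁ t with critical ls g t
      ...   | here (f , f′) = inj₁ (g , t ∷ f ∷ f′ ∷ [])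

    bounded-two : ∀ {P Q Ls} → Links S (pos a) (P ∷ Q ∷ Ls) → Bounded S
    bounded-two ls with occs ls | distinct ls
    ... | o₁ ∷ o₂ ∷ _ | (d₁₂ ∷ _) ∷ _ = Card-⊎ split
        (under-links {c = 5817} (paired-free w pd) (o₁ ∷ o₂ ∷ []) ((d₁₂ ∷ []) ∷ [] ∷ []) (fits _))
        (leaf 3970 (pos a) (m ∷ []) w S≤ (pair-fresh-opp pd) (pair-drop pd) (fits _)) _
      where
      split : ∀ {M} → Good S M → Under S (neg a ∷ []) M ⊎ Under S (pos a ∷ m ∷ []) M
      split g with pair-split pd g
      ... | inj₁ f = inj₁ (g , f ∷ [])
      ... | inj₂ u = inj₂ u

    bounded : ∀ {Ls} → Links S (pos a) Ls → Bounded S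
    bounded {[]}        = bounded-none
    bounded {_ ∷ []}    = bounded-one
    bounded {_ ∷ _ ∷ _} = bounded-two

  -- A pair with a negative literal is handled from that literal. For two positive literals, either
  -- `c` has no further positive occurrence, or it occurs with both signs, or `neg c` does not
  -- occur; this last purity is what the analysis by the occurrences of `a` relies on.
  bounded-pair : Three S → ∀ {l m} → Paired S l m → Bounded S
  bounded-pair three {neg a} pd = NegativeLiteral.bounded pd (proj₂ (find-links w three (pos a)))
  bounded-pair three {pos a} {neg c} pd = NegativeLiteral.bounded (paired-sym pd) (proj₂ (find-links w three (pos c)))
  bounded-pair three {pos a} {pos c} pd with find-links w three (pos c) | find-links w three (neg c)
  ... | [] , ls         | _            = PositiveLiteral.bounded-none (paired-sym pd) ls
  ... | _ ∷ _ , ls      | _ ∷ _ , ls′  = bounded-both (paired-sym pd) (All.head (occs ls)) (All.head (occs ls′))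
  ... | _ ∷ _ , _       | [] , pure with find-links w three (pos a)
  ...   | [] , ls             = PositiveLiteral.bounded-none pd ls
  ...   | _ ∷ [] , ls         = PositiveLiteral.bounded-one pd ls
  ...   | _ ∷ _ ∷ [] , ls     = PositiveLiteral.bounded-two pd pure ls
  ...   | _ ∷ _ ∷ _ ∷ _ , ls  = PositiveLiteral.bounded-three pd pure ls

-- States without pairs

module _ {A : Set} {P : A → Set} (P? : ∀ x → Dec (P x)) where

  filter-two : ∀ {xs x y} → x ∈ xs → y ∈ xs → x ≢ y → ¬ P x → ¬ P y → 2 + length (filter P? xs) ≤ length xs
  filter-two (here refl) (here refl) x≢y _ _ = contradiction refl x≢y
  filter-two {_ ∷ xs} (here refl) (there y∈) _ ¬x ¬y rewrite filter-reject P? {xs = xs} ¬x =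
    s≤s (filter-notAll P? xs (lose y∈ ¬y))
  filter-two {_ ∷ xs} (there x∈) (here refl) _ ¬x ¬y rewrite filter-reject P? {xs = xs} ¬y =
    s≤s (filter-notAll P? xs (lose x∈ ¬x))
  filter-two {z ∷ xs} (there x∈) (there y∈) x≢y ¬x ¬y with P? z
  ... | yes _ = s≤s (filter-two x∈ y∈ x≢y ¬x ¬y)
  ... | no  _ = m≤n⇒m≤1+n (filter-two x∈ y∈ x≢y ¬x ¬y)

  filter-split : ∀ xs → length (filter P? xs) + length (filter (¬? ∘ P?) xs) ≡ length xs
  filter-split []       = refl
  filter-split (x ∷ xs) with P? x
  ... | yes _ = cong suc (filter-split xs)
  ... | no  _ = trans (+-suc _ _) (cong suc (filter-split xs))

  filter-grows : ∀ y xs → length (filter P? xs) ≤ length (filter P? (y ∷ xs))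
  filter-grows y xs with P? y
  ... | yes _ = n≤1+n _
  ... | no  _ = ≤-refl

_∈ᶜ?_ : (l : Literal N) (P : Pair N) → Dec (l ∈ pairClause P)
l ∈ᶜ? P = any? (l ≟_) (pairClause P)

Opposed : List (Pair N) → Set
Opposed Ds = Any (λ P → Any (λ y → Any (λ Q → opp y ∈ pairClause Q) Ds) (pairClause P)) Ds

opposed? : (Ds : List (Pair N)) → Dec (Opposed Ds)
opposed? Ds = any? (λ P → any? (λ y → any? (λ Q → opp y ∈ᶜ? Q) Ds) (pairClause P)) Ds

Consistent : List (Pair N) → Set
Consistent Ds = ∀ {P Q y} → P ∈ Ds → Q ∈ Ds → y ∈ pairClause P → ¬ opp y ∈ pairClause Q

¬opposed⇒consistent : ∀ {Ds : List (Pair N)} → ¬ Opposed Ds → Consistent Ds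
¬opposed⇒consistent ¬o P∈ Q∈ y∈ y∈′ = ¬o (lose P∈ (lose y∈ (lose Q∈ y∈′)))

others : Literal N → List (Pair N) → List (Pair N)
others y = filter (λ P → ¬? (y ∈ᶜ? P))

holders : Literal N → List (Pair N) → List (Pair N)
holders y = filter (y ∈ᶜ?_)

-- Consistency excludes complementary literals, so clauses with a common atom have a common literal.
disjoint-or-shared : ∀ (Ds : List (Pair N)) → Consistent Ds →
                     AllPairs Disjoint Ds ⊎ (∃ λ y → 2 ≤ length (holders y Ds))
disjoint-or-shared [] _ = inj₁ []
disjoint-or-shared (P ∷ Ds) con with any? (λ y → any? (y ∈ᶜ?_) Ds) (pairClause P)
... | yes s with find s
...   | y , y∈ , t = inj₂ (y , subst (2 ≤_) (cong length (sym (filter-accept (y ∈ᶜ?_) {P} {Ds} y∈)))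
  (s≤s (filter-some (y ∈ᶜ?_) t)))
disjoint-or-shared (P ∷ Ds) con | no ¬s with disjoint-or-shared Ds (λ P∈ Q∈ → con (there P∈) (there Q∈))
... | inj₁ ds = inj₁ (All.tabulate (λ {Q} Q∈ → λ { (inj₁ refl) → apart-from-P (here refl) Q∈ ; (inj₂ refl) → apart-from-P (there (here refl)) Q∈ }) ∷ ds)
  where
  apart-from-P : ∀ {y Q} → y ∈ pairClause P → Q ∈ Ds → ¬ Touches (atom y) Q
  apart-from-P {y} {Q} y∈ Q∈ = avoids y {Q} (λ p → ¬s (lose y∈ (lose Q∈ p))) (con (here refl) (there Q∈) y∈)
... | inj₂ (y , le) = inj₂ (y , ≤-trans le (filter-grows (y ∈ᶜ?_) P Ds))

-- Coefficients of states without pairs with j pairwise disjoint 2-clauses,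
-- respectively with j distinct ones.
disjointWeight pairlessWeight : ℕ → ℕ
disjointWeight 0 = 10000
disjointWeight 1 = 9033
disjointWeight 2 = 8159
disjointWeight 3 = 7370
disjointWeight 4 = 6657
disjointWeight _ = 6013
pairlessWeight 0 = 10000
pairlessWeight 1 = 9033
pairlessWeight 2 = 8159
pairlessWeight 3 = 7557
pairlessWeight 4 = 7172
pairlessWeight _ = 6674

private
  -- pairlessWeight B / 1.67 and 10⁴ / 1.67^(1 + A), rounded up
  trueWeight falseWeight : ℕ → ℕ
  trueWeight 0 = 5989
  trueWeight 1 = 5409
  trueWeight 2 = 4886
  trueWeight _ = 4526
  falseWeight 2 = 2148
  falseWeight 3 = 1286
  falseWeight 4 = 770
  falseWeight _ = 462

  disjoint-fits : ∀ j → Fits (disjointWeight j) 0 0 1 (disjointWeight (suc j))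
  disjoint-fits 0 = fits _
  disjoint-fits 1 = fits _
  disjoint-fits 2 = fits _
  disjoint-fits 3 = fits _
  disjoint-fits 4 = fits _
  disjoint-fits (suc (suc (suc (suc (suc _))))) = fits _

  disjoint≤pairless : ∀ j → j ≤ 5 → T (disjointWeight j ≤ᵇ pairlessWeight j)
  disjoint≤pairless 0 _ = _
  disjoint≤pairless 1 _ = _
  disjoint≤pairless 2 _ = _
  disjoint≤pairless 3 _ = _
  disjoint≤pairless 4 _ = _
  disjoint≤pairless 5 _ = _
  disjoint≤pairless (suc (suc (suc (suc (suc (suc _)))))) (s≤s (s≤s (s≤s (s≤s (s≤s ())))))

  Enough : ℕ → ℕ → Set
  Enough A B = Fits (pairlessWeight B) 1 0 0 (trueWeight B) × Fits 10000 (suc A) 0 0 (falseWeight A) × T (trueWeight B + falseWeight A ≤ᵇ pairlessWeight (A + B))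

  -- `A` of the 2-clauses contain a literal `y` and `B` do not. With `y` true the `B` others remain;
  -- with `y` false the `A` partners are forced. The coefficients for three and for five 2-clauses
  -- come from the worst split, `A` = 2.
  enough : ∀ A B → 2 ≤ A → A + B ≤ 5 → Enough A B
  enough 2 0 _ _ = fits _ , fits _ , _
  enough 2 1 _ _ = fits _ , fits _ , _
  enough 2 2 _ _ = fits _ , fits _ , _
  enough 2 3 _ _ = fits _ , fits _ , _
  enough 3 0 _ _ = fits _ , fits _ , _
  enough 3 1 _ _ = fits _ , fits _ , _
  enough 3 2 _ _ = fits _ , fits _ , _
  enough 4 0 _ _ = fits _ , fits _ , _
  enough 4 1 _ _ = fits _ , fits _ , _
  enough 5 0 _ _ = fits _ , fits _ , _
  enough 1 _ (s≤s ()) _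
  enough 2 (suc (suc (suc (suc _)))) _ (s≤s (s≤s (s≤s (s≤s (s≤s ())))))
  enough 3 (suc (suc (suc _))) _ (s≤s (s≤s (s≤s (s≤s (s≤s ())))))
  enough 4 (suc (suc _)) _ (s≤s (s≤s (s≤s (s≤s (s≤s ())))))
  enough 5 (suc _) _ (s≤s (s≤s (s≤s (s≤s (s≤s ())))))
  enough (suc (suc (suc (suc (suc (suc _)))))) _ _ (s≤s (s≤s (s≤s (s≤s (s≤s ())))))

record NoPairs (S : State N) : Set where
  constructor no-pairs
  field
    no-pairs-≡ : pairs S ≡ []
open NoPairs

module _ {S : State N} (np : NoPairs S) where

  no-pair : ∀ {P} → ¬ P ∈ pairs S
  no-pair P∈ with subst (_ ∈_) (no-pairs-≡ np) P∈
  ... | ()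

  all-untouched : ∀ a → Untouched S a
  all-untouched a = untouched λ P∈ → contradiction P∈ no-pair

  no-pairs-assign : ∀ l → NoPairs (assign l S)
  no-pairs-assign l = no-pairs (cong (filter (λ P → ¬? (touches? (atom l) P))) (no-pairs-≡ np))

  not-paired : ∀ {l m} → ¬ Paired S l m
  not-paired (fwd p) = no-pair p
  not-paired (bwd p) = no-pair p

  not-subsumed : ∀ {C} → ¬ Subsumed S C
  not-subsumed s with find s
  ... | _ , P∈ , _ = no-pair P∈

  clauses-rest : ∀ {C} → C ∈ clauses S → C ∈ rest S
  clauses-rest C∈ = subst (λ Ps → _ ∈ map pairClause Ps ++ rest S) (no-pairs-≡ np) C∈

no-drop : ∀ {S : State N} → NoPairs S → ∀ ls → Drop S ls 0
no-drop np []       = done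
no-drop np (l ∷ ls) = miss (all-untouched np (atom l)) (no-drop (no-pairs-assign np l) ls)

-- Two partners on one atom would be equal, making their clauses the same, or complementary, against
-- consistency. So falsifying `y` assigns a new atom for each clause.
partners : ∀ {S : State N} y A → All (Link S) A → All (λ P → y ∈ pairClause P) A → AllPairs Distinct A → Consistent A →
           ∃ λ zs → length zs ≡ length A × All (λ z → Link S (y , z) × ∃ λ Q → Q ∈ A × Same (y , z) Q) zs × Unique (map atom zs)
partners y [] _ _ _ _ = [] , refl , [] , []
partners {S = S} y (P ∷ A) (k ∷ ks) (p ∷ ps) (d ∷ ds) con with partners y A ks ps ds (λ P∈ Q∈ → con (there P∈) (there Q∈)) | orient p k
... | zs , len , lz , un | z , k′ , s =
  z ∷ zs , cong suc len , (k′ , P , here refl , s) ∷ All.map (λ { (k , Q , Q∈ , s) → k , Q , there Q∈ , s }) lz , fresh-z lz ∷ un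
  where
  in-same : ∀ {y z P} → Same {N = _} (y , z) P → z ∈ pairClause P
  in-same (inj₁ refl) = there (here refl)
  in-same (inj₂ refl) = here refl
  differ : ∀ {z′ Q} → Q ∈ A → Same (y , z′) Q → atom z ≢ atom z′
  differ {z′} {Q} Q∈ s′ q with atom-≡ z z′ q
  ... | inj₁ refl = All.lookup d Q∈ (same-join s s′)
  ... | inj₂ refl = con (there Q∈) (here refl) (in-same s′) (in-same s)
  fresh-z : ∀ {zs} → All (λ z → Link S (y , z) × ∃ λ Q → Q ∈ A × Same (y , z) Q) zs → All (atom z ≢_) (map atom zs)
  fresh-z [] = []
  fresh-z ((_ , Q , Q∈ , s′) ∷ r) = differ Q∈ s′ ∷ fresh-z r

avoiding : Fin N → List (Pair N) → List (Pair N)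
avoiding a = filter (λ P → ¬? (touches? a P))

touches-same : ∀ {l m : Literal N} {Q} → Same (l , m) Q → Touches (atom l) Q
touches-same (inj₁ refl) = inj₁ refl
touches-same (inj₂ refl) = inj₂ refl

avoiding-fewer : ∀ {a : Fin N} {Ps Q} → Q ∈ Ps → Touches a Q → 1 + length (avoiding a Ps) ≤ length Ps
avoiding-fewer {a = a} {Ps} Q∈ t = filter-notAll (λ P → ¬? (touches? a P)) Ps (lose Q∈ λ ¬t → ¬t t)

-- Branching in the absence of pairs

module NoPair {b : ℕ} (ih : IH N b) where
  open Step ih

  -- No branching takes place: each link becomes a pair and contributes a factor x.
  count-disjoint : ∀ {S : State N} → WF S → length (free S) < b → ∀ Ds → All (Link S) Ds → AllPairs Disjoint Ds →
                   All (λ P → Untouched S (atom (proj₁ P)) × Untouched S (atom (proj₂ P))) Ds → Count S (disjointWeight (length Ds))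
  count-disjoint w S< [] _ _ _ = ih w S<
  count-disjoint {S = S} w S< (D ∷ Ds) (k ∷ ks) (d ∷ ds) ((p , q) ∷ us) = count-addPair k
    (count-disjoint (wf-addPair k w p q) S< Ds
      (All.tabulate λ {Q} Q∈ → link-addPair k (disjoint⇒distinct (All.lookup d Q∈)) (All.lookup ks Q∈)) ds
      (All.tabulate λ {Q} Q∈ → keep {Q = Q} (inj₁ refl) (All.lookup d Q∈) (proj₁ (All.lookup us Q∈)) ,
                               keep {Q = Q} (inj₂ refl) (All.lookup d Q∈) (proj₂ (All.lookup us Q∈))))
    (disjoint-fits (length Ds))
    where
    disjoint⇒distinct : ∀ {Q} → Disjoint D Q → Distinct D Q
    disjoint⇒distinct d (inj₁ refl) = d (inj₁ refl) (inj₁ refl)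
    disjoint⇒distinct d (inj₂ refl) = d (inj₁ refl) (inj₂ refl)
    keep : ∀ {a Q} → Touches a Q → Disjoint D Q → Untouched S a → Untouched (addPair D S) a
    keep t d u = untouched λ { (here refl) t′ → d t′ t ; (there P∈) → none u P∈ }

  -- Each value of `y` forces the other literal of one link, so the total is 2/τ².
  count-opposed : ∀ {S : State N} → WF S → length (free S) < b → NoPairs S → ∀ {y z z′} →
                  Link S (y , z) → Link S (opp y , z′) → Count S 7172
  count-opposed {S = S} w S< np {y} {z} {z′} k k′ = Card-⊎ split
    (leaf 3586 y (z′ ∷ []) w (≤-trans (n≤1+n _) S<)
      (subst (λ l → Fresh S (l ∷ z′ ∷ [])) (opp-opp y) (opp-first (opp y) (new k′))) (no-drop np _) (fits _))
    (leaf 3586 (opp y) (z ∷ []) w (≤-trans (n≤1+n _) S<) (opp-first y (new k)) (no-drop np _) (fits _)) _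
    where
    split : ∀ {M} → Good S M → Under S (y ∷ z′ ∷ []) M ⊎ Under S (opp y ∷ z ∷ []) M
    split {M} g with holds-or-opp M y
    ... | inj₁ t = inj₁ (g , t ∷ other-holds g (entailed k′) (λ f → not-both y t f) ∷ [])
    ... | inj₂ f = inj₂ (g , f ∷ other-holds g (entailed k) (λ t → not-both y t f) ∷ [])

  -- Unless the links are disjoint, some `y` lies in two of them. Making `y` true leaves the links
  -- without `y`, which survive because consistency keeps `opp y` out of them; `j` is fuel for this
  -- recursion. Making `y` false forces all its partners.
  count-consistent : ∀ j {S : State N} → WF S → length (free S) < b → NoPairs S → ∀ Ds → length Ds ≤ j → length Ds ≤ 5 →
                     All (Link S) Ds → AllPairs Distinct Ds → Consistent Ds → Count S (pairlessWeight (length Ds))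
  count-consistent _ w S< np [] _ _ _ _ _ = ih w S<
  count-consistent (suc j) {S} w S< np Ds@(_ ∷ _) len≤ ≤5 ks ds con with disjoint-or-shared Ds con
  ... | inj₁ dis = Card-mono (disjoint≤pairless (length Ds) ≤5) (count-disjoint w S< Ds ks dis (All.tabulate λ _ → all-untouched np _ , all-untouched np _))
  ... | inj₂ (y , two) with partners y (holders y Ds) (All.filter⁺ (y ∈ᶜ?_) ks) (All.all-filter (y ∈ᶜ?_) Ds) (AllPairs.filter⁺ (y ∈ᶜ?_) ds) conA
    where
    conA : Consistent (holders y Ds)
    conA P∈ Q∈ = con (proj₁ (∈-filter⁻ (y ∈ᶜ?_) {xs = Ds} P∈)) (proj₁ (∈-filter⁻ (y ∈ᶜ?_) {xs = Ds} Q∈))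
  ...   | zs , len , lz , un = go zs len lz un
    where
    A = holders y Ds
    y∉? = λ P → ¬? (y ∈ᶜ? P)
    B = others y Ds
    total : length A + length B ≡ length Ds
    total = filter-split (y ∈ᶜ?_) Ds
    B≤ : length B ≤ j
    B≤ = ≤-pred (≤-trans (+-monoˡ-≤ (length B) (≤-trans (s≤s z≤n) two)) (≤-trans (≤-reflexive total) len≤))
    holder : ∀ {A} → 2 ≤ length A → (∀ {P} → P ∈ A → P ∈ Ds × y ∈ pairClause P) → ∃ λ P → P ∈ Ds × y ∈ pairClause P
    holder {P ∷ _} _ inc = P , inc (here refl)
    someone = holder two (∈-filter⁻ (y ∈ᶜ?_) {xs = Ds})
    y∈ : atom y ∈ free S
    y∈ with orient (proj₂ (proj₂ someone)) (All.lookup ks (proj₁ (proj₂ someone)))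
    ... | _ , k , _ = link-free₁ k
    linksB : All (Link (assign y S)) B
    linksB = All.tabulate λ {Q} Q∈ → let (Q∈Ds , y∉) = ∈-filter⁻ y∉? {xs = Ds} Q∈ in
      link-assign y (All.lookup ks Q∈Ds) (avoids y {Q} y∉ (con (proj₁ (proj₂ someone)) Q∈Ds (proj₂ (proj₂ someone))))
    conB : Consistent B
    conB P∈ Q∈ = con (proj₁ (∈-filter⁻ y∉? {xs = Ds} P∈)) (proj₁ (∈-filter⁻ y∉? {xs = Ds} Q∈))
    B≤5 : length B ≤ 5
    B≤5 = ≤-trans (length-filter y∉? Ds) ≤5
    f₁ : Fresh S (y ∷ [])
    f₁ = fresh (y∈ ∷ []) ([] ∷ [])
    go : ∀ zs → length zs ≡ length A → All (λ z → Link S (y , z) × ∃ λ Q → Q ∈ A × Same (y , z) Q) zs → Unique (map atom zs) →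
         Count S (pairlessWeight (length Ds))
    go zs len lz un with enough (length A) (length B) two (≤-trans (≤-reflexive total) ≤5)
    ... | fitB , fitA , sum = Card-⊎ split
      (count-under (trueWeight (length B)) (y ∷ []) w f₁ (no-drop np _)
        (count-consistent j (wf-assign y w) (<-≤-trans (free-shrinks y {S} y∈) (≤-trans (n≤1+n _) S<)) (no-pairs-assign np y) B B≤ B≤5 linksB
          (AllPairs.filter⁺ y∉? ds) conB) fitB)
      (leaf (falseWeight (length A)) (opp y) zs w (≤-trans (n≤1+n _) S<)
        (opp-first y (fresh (y∈ ∷ frees lz) (aparts lz ∷ un))) (no-drop np _)
        (subst (λ n → Fits 10000 (suc n) 0 0 (falseWeight (length A))) (sym len) fitA))
      (subst (λ n → T (trueWeight (length B) + falseWeight (length A) ≤ᵇ pairlessWeight n)) total sum)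
      where
      frees : ∀ {R : Literal N → Set} {zs} → All (λ z → Link S (y , z) × R z) zs → All (_∈ free S) (map atom zs)
      frees []             = []
      frees ((k , _) ∷ r) = link-free₂ k ∷ frees r
      aparts : ∀ {R : Literal N → Set} {zs} → All (λ z → Link S (y , z) × R z) zs → All (atom y ≢_) (map atom zs)
      aparts []             = []
      aparts ((k , _) ∷ r) = link-apart k ∷ aparts r
      split : ∀ {M} → Good S M → Under S (y ∷ []) M ⊎ Under S (opp y ∷ zs) M
      split {M} g with holds-or-opp M y
      ... | inj₁ t = inj₁ (g , t ∷ [])
      ... | inj₂ f = inj₂ (g , f ∷ All.map (λ { (k , _) → other-holds g (entailed k) (λ t → not-both y t f) }) lz)

  -- The opposed branching gives 7172, below the coefficient 7557 for three links but above the one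
  -- for five. With more links consistency must come from elsewhere, namely from all literals being
  -- positive.
  count-few-links : ∀ {S : State N} → WF S → length (free S) < b → NoPairs S → ∀ Ds → length Ds ≤ 3 →
                    All (Link S) Ds → AllPairs Distinct Ds → Count S (pairlessWeight (length Ds))
  count-few-links {S} w S< np Ds ≤3 ks ds with opposed? Ds
  ... | no ¬o = count-consistent 3 w S< np Ds ≤3 (≤-trans ≤3 (s≤s (s≤s (s≤s z≤n)))) ks ds (¬opposed⇒consistent ¬o)
  ... | yes o with find o
  ...   | P , P∈ , o′ with find o′
  ...   | y , y∈ , o″ with find o″
  ...   | Q , Q∈ , y∈′ with orient y∈ (All.lookup ks P∈) | orient y∈′ (All.lookup ks Q∈)
  ...   | _ , k , _ | _ , k′ , _ = Card-mono (opposed≤pairless (length Ds) ≤3) (count-opposed w S< np k k′)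
    where
    opposed≤pairless : ∀ j → j ≤ 3 → T (7172 ≤ᵇ pairlessWeight j)
    opposed≤pairless 0 _ = _
    opposed≤pairless 1 _ = _
    opposed≤pairless 2 _ = _
    opposed≤pairless 3 _ = _
    opposed≤pairless (suc (suc (suc (suc _)))) (s≤s (s≤s (s≤s ())))

  module _ {S : State N} (w : WF S) (S≤ : length (free S) ≤ b) (np : NoPairs S) where

    under-few : ∀ {l Qs c} → atom l ∈ free S → length Qs ≤ 3 → All (Occ S (opp l)) Qs → AllPairs Distinct Qs →
                Fits (pairlessWeight (length Qs)) 1 0 0 c → CountUnder S (l ∷ []) c
    under-few {l} {Qs} {c} l∈ ≤3 os ds check = count-under c (l ∷ []) w fr (no-drop np _)
      (count-few-links (wf-assign l w) (small-assign* l [] S≤ fr) (no-pairs-assign np l) Qs ≤3 (All.map (occ-link l) os) ds) check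
      where fr = fresh (l∈ ∷ []) ([] ∷ [])

    support₀ : ∀ {a Ls M} → Links S (pos a) Ls → Good S M → a ∈ free S → a ∈ˢ M → Any (Falsified M) Ls
    support₀ ls g a∈ t with support w g ls a∈ t
    ... | inj₁ (_ , pd , _) = contradiction pd (not-paired np)
    ... | inj₂ q = q

    falsify-leaf : ∀ {a P} → a ∈ free S → Occ S (pos a) P → CountUnder S (pos a ∷ opp (proj₁ P) ∷ opp (proj₂ P) ∷ []) 2148
    falsify-leaf {a} {u , v} a∈ o with pair-fresh o
    ... | fresh fs us = leaf 2148 (pos a) (opp u ∷ opp v ∷ []) w S≤
      (fresh-cong {ls = pos a ∷ u ∷ v ∷ []} {pos a ∷ opp u ∷ opp v ∷ []}
        (cong₂ (λ x y → a ∷ x ∷ y ∷ []) (sym (atom-opp u)) (sym (atom-opp v)))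
        (fresh (a∈ ∷ fs) (((λ q → apart-from o (inj₁ q)) ∷ (λ q → apart-from o (inj₂ q)) ∷ []) ∷ us)))
      (no-drop np _) (fits _)

    count-one-link : ∀ {a Ls} → a ∈ free S → Links S (pos a) Ls → length Ls ≤ 1 → Count S 8137
    count-one-link {a} {[]} a∈ ls _ = Card-mono _ (Card-⊆ only
      (under-few {neg a} {[]} {5989} a∈ z≤n [] [] (fits _)))
      where
      only : ∀ {M} → Good S M → Under S (neg a ∷ []) M
      only {M} g with holds-or-opp M (pos a)
      ... | inj₂ q = g , q ∷ []
      ... | inj₁ t with support₀ ls g a∈ t
      ...   | ()
    count-one-link {a} {P ∷ []} a∈ ls _ with occs ls
    ... | o ∷ [] = Card-⊎ split (falsify-leaf a∈ o) (under-few {neg a} {[]} {5989} a∈ z≤n [] [] (fits _)) _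
      where
      split : ∀ {M} → Good S M → Under S (pos a ∷ opp (proj₁ P) ∷ opp (proj₂ P) ∷ []) M ⊎ Under S (neg a ∷ []) M
      split {M} g with holds-or-opp M (pos a)
      ... | inj₂ q = inj₂ (g , q ∷ [])
      ... | inj₁ t with support₀ ls g a∈ t
      ...   | here (p , q) = inj₁ (g , t ∷ p ∷ q ∷ [])
    count-one-link {Ls = _ ∷ _ ∷ _} _ _ (s≤s ())

    -- If `a` is true, one of its clauses is critical, which falsifies two more atoms; if `a` is
    -- false, two links arise. With three clauses the same scheme would cost 3 · 2148 + 4526, more
    -- than 10000.
    count-two-links : ∀ {a Ls} → a ∈ free S → Links S (pos a) Ls → length Ls ≤ 2 → Count S 9182
    count-two-links {Ls = []}     a∈ ls _ = Card-mono _ (count-one-link a∈ ls z≤n)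
    count-two-links {Ls = _ ∷ []} a∈ ls _ = Card-mono _ (count-one-link a∈ ls (s≤s z≤n))
    count-two-links {a} {P ∷ Q ∷ []} a∈ ls le with occs ls
    ... | o₁ ∷ o₂ ∷ [] = Card-⊎ split (Card-+ (falsify-leaf a∈ o₁) (falsify-leaf a∈ o₂))
      (under-few {neg a} {c = 4886} a∈ (m≤n⇒m≤1+n le) (occs ls) (distinct ls) (fits _)) _
      where
      split : ∀ {M} → Good S M → (Under S (pos a ∷ opp (proj₁ P) ∷ opp (proj₂ P) ∷ []) M ⊎
                                  Under S (pos a ∷ opp (proj₁ Q) ∷ opp (proj₂ Q) ∷ []) M) ⊎ Under S (neg a ∷ []) M
      split {M} g with holds-or-opp M (pos a)
      ... | inj₂ q = inj₂ (g , q ∷ [])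
      ... | inj₁ t with support₀ ls g a∈ t
      ...   | here (p , q)         = inj₁ (inj₁ (g , t ∷ p ∷ q ∷ []))
      ...   | there (here (p , q)) = inj₁ (inj₂ (g , t ∷ p ∷ q ∷ []))
    count-two-links {Ls = _ ∷ _ ∷ _ ∷ _} _ _ (s≤s (s≤s ()))

    plain-split : ∀ a {M} → Good S M → Under S (pos a ∷ []) M ⊎ Under S (neg a ∷ []) M
    plain-split a {M} g with holds-or-opp M (pos a)
    ... | inj₁ t = inj₁ (g , t ∷ [])
    ... | inj₂ q = inj₂ (g , q ∷ [])

    -- Both values of `a` create 2-clauses: one when it is true, three when it is false.
    bounded-mixed : ∀ {a P Q R D Ls Ls′} → a ∈ free S → Links S (pos a) (P ∷ Q ∷ R ∷ Ls) → Links S (neg a) (D ∷ Ls′) → Bounded S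
    bounded-mixed {a} a∈ ls ls′ with occs ls | distinct ls | occs ls′
    ... | o₁ ∷ o₂ ∷ o₃ ∷ _ | (d₁₂ ∷ d₁₃ ∷ _) ∷ (d₂₃ ∷ _) ∷ _ | o′ ∷ _ = Card-⊎ (plain-split a)
      (under-few {pos a} {c = 5410} a∈ (s≤s z≤n) (o′ ∷ []) ([] ∷ []) (fits _))
      (under-few {neg a} {c = 4526} a∈ ≤-refl (o₁ ∷ o₂ ∷ o₃ ∷ []) ((d₁₂ ∷ d₁₃ ∷ []) ∷ (d₂₃ ∷ []) ∷ [] ∷ []) (fits _)) _

    module _ (pure : ∀ {C a} → C ∈ rest S → ¬ neg a ∈ C) where

      occ-consistent : ∀ {l Ls} → All (Occ S l) Ls → Consistent Ls
      occ-consistent {l} os {P} {Q} {y} P∈ Q∈ y∈ y∈′ = clash y (side y∈ (All.lookup os P∈)) (side y∈′ (All.lookup os Q∈))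
        where
        side : ∀ {z R} → z ∈ pairClause R → Occ S l R → ∃ λ C → C ∈ rest S × z ∈ C
        side (here refl) o         = _ , host-∈ o , fst-∈ o
        side (there (here refl)) o = _ , host-∈ o , snd-∈ o
        clash : ∀ y → (∃ λ C → C ∈ rest S × y ∈ C) → (∃ λ C → C ∈ rest S × opp y ∈ C) → ⊥
        clash (pos _) _ (_ , C∈ , n) = pure C∈ n
        clash (neg _) (_ , C∈ , n) _ = pure C∈ n

      under-consistent : ∀ {a Ls c} → a ∈ free S → length Ls ≤ 5 → All (Occ S (pos a)) Ls → AllPairs Distinct Ls →
                         Fits (pairlessWeight (length Ls)) 1 0 0 c → CountUnder S (neg a ∷ []) c
      under-consistent {a} {Ls} {c} a∈ ≤5 os ds check = count-under c (neg a ∷ []) w fr (no-drop np _)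
        (count-consistent 5 (wf-assign (neg a) w) (small-assign* (neg a) [] S≤ fr) (no-pairs-assign np (neg a)) Ls ≤5 ≤5
          (All.map (occ-link (neg a)) os) ds (occ-consistent os)) check
        where fr = fresh (a∈ ∷ []) ([] ∷ [])

      under-disjoint : ∀ {a Ls c} → a ∈ free S → All (Occ S (pos a)) Ls → AllPairs Disjoint Ls →
                       Fits (disjointWeight (length Ls)) 1 0 0 c → CountUnder S (neg a ∷ []) c
      under-disjoint {a} {Ls} {c} a∈ os ds check = count-under c (neg a ∷ []) w fr (no-drop np _)
        (count-disjoint (wf-assign (neg a) w) (small-assign* (neg a) [] S≤ fr) Ls
          (All.map (occ-link (neg a)) os) ds (All.tabulate λ _ → all-untouched np′ _ , all-untouched np′ _)) check
        where
        fr = fresh (a∈ ∷ []) ([] ∷ [])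
        np′ = no-pairs-assign np (neg a)

      -- Five occurrences suffice however the clauses overlap: 5989 for `a` true and 6674/τ for `a`
      -- false.
      bounded-five : ∀ {a P₁ P₂ P₃ P₄ P₅ Ls} → a ∈ free S → Links S (pos a) (P₁ ∷ P₂ ∷ P₃ ∷ P₄ ∷ P₅ ∷ Ls) → Bounded S
      bounded-five {a} a∈ ls with occs ls | distinct ls
      ... | o₁ ∷ o₂ ∷ o₃ ∷ o₄ ∷ o₅ ∷ _ |
            (d₁₂ ∷ d₁₃ ∷ d₁₄ ∷ d₁₅ ∷ _) ∷ (d₂₃ ∷ d₂₄ ∷ d₂₅ ∷ _) ∷ (d₃₄ ∷ d₃₅ ∷ _) ∷ (d₄₅ ∷ _) ∷ _ = Card-⊎ (plain-split a)
        (under-few {pos a} {[]} {5989} a∈ z≤n [] [] (fits _))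
        (under-consistent {c = 3997} a∈ ≤-refl (o₁ ∷ o₂ ∷ o₃ ∷ o₄ ∷ o₅ ∷ [])
          ((d₁₂ ∷ d₁₃ ∷ d₁₄ ∷ d₁₅ ∷ []) ∷ (d₂₃ ∷ d₂₄ ∷ d₂₅ ∷ []) ∷ (d₃₄ ∷ d₃₅ ∷ []) ∷ (d₄₅ ∷ []) ∷ [] ∷ []) (fits _)) _

      private
        rest-assign⁺ : ∀ {a C} → C ∈ rest S → ¬ pos a ∈ C → C ∈ rest (assign (pos a) S)
        rest-assign⁺ {a} {C} C∈ a∉ = subst (_∈ rest (assign (pos a) S))
          (filter-all (λ m → ¬? (m ≟ neg a)) (All.tabulate λ { m∈ refl → pure C∈ m∈ }))
          (without⁺ (pos a) {S} (rest-∈ {S = S} C∈) a∉)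

        rest-assign⁻ : ∀ {a C} → C ∈ rest (assign (pos a) S) → C ∈ rest S × ¬ pos a ∈ C
        rest-assign⁻ {a} C∈ with ∈-map⁻ _ C∈
        ... | D , D∈ , refl with ∈-filter⁻ _ {xs = clauses S} D∈
        ... | D∈S , a∉ = subst (λ E → E ∈ rest S × ¬ pos a ∈ E)
          (sym (filter-all (λ m → ¬? (m ≟ neg a)) (All.tabulate λ { m∈ refl → pure D∈r m∈ }))) (D∈r , a∉)
          where D∈r = clauses-rest np D∈S

      -- Without negative literals, making `a` true only deletes clauses, so `c` loses exactly its
      -- clauses with `a` and no other clause changes.
      links-assign : ∀ {a c Ls} → a ≢ c → Links S (pos c) Ls → Links (assign (pos a) S) (pos c) (avoiding a Ls)
      links-assign {a} {c} {Ls} a≢c ls = links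
        (All.tabulate λ Q∈ → let (Q∈Ls , ¬t) = ∈-filter⁻ (λ P → ¬? (touches? a P)) {xs = Ls} Q∈ in keep (All.lookup (occs ls) Q∈Ls) ¬t)
        (AllPairs.filter⁺ (λ P → ¬? (touches? a P)) (distinct ls)) cov
        where
        keep : ∀ {Q} → Occ S (pos c) Q → ¬ Touches a Q → Occ (assign (pos a) S) (pos c) Q
        keep {Q} o ¬t with pair-fresh o
        ... | fresh (f₁ ∷ f₂ ∷ []) us = occ (rest-assign⁺ (host-∈ o) a∉) (not-subsumed (no-pairs-assign np (pos a)))
          (l-∈ o) (fst-∈ o) (snd-∈ o) (exact o) (apart-from o)
          (fresh (free-assign⁺ (pos a) {S} f₁ (λ q → ¬t (inj₁ (sym q))) ∷ free-assign⁺ (pos a) {S} f₂ (λ q → ¬t (inj₂ (sym q))) ∷ []) us)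
          where
          a∉ : ¬ pos a ∈ host o
          a∉ a∈ with exact o a∈
          ... | here refl                = a≢c refl
          ... | there (here refl)        = ¬t (inj₁ refl)
          ... | there (there (here refl)) = ¬t (inj₂ refl)
        cov : ∀ {C} → C ∈ rest (assign (pos a) S) → pos c ∈ C → ¬ Subsumed (assign (pos a) S) C →
              Any (λ P → proj₁ P ∈ C × proj₂ P ∈ C) (avoiding a Ls)
        cov {C} C∈ c∈ _ with rest-assign⁻ C∈
        ... | C∈S , a∉ with find (complete ls C∈S c∈ (not-subsumed np))
        ... | Q , Q∈ , (q₁ , q₂) = lose (∈-filter⁺ (λ P → ¬? (touches? a P)) Q∈ λ { (inj₁ e) → off q₁ e ; (inj₂ e) → off q₂ e }) (q₁ , q₂)
          where
          off : ∀ {y} → y ∈ C → a ≢ atom y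
          off {pos _} y∈ refl = a∉ y∈
          off {neg _} y∈ refl = pure C∈S y∈

      -- The clause `a ∨ c ∨ z` listed under `a` must also be covered by the list for `c`, and the
      -- two literals recorded there can only be `pos a` and `z`.
      meeting : ∀ {a c z P Lc} → Occ S (pos a) P → Same (pos c , z) P → Links S (pos c) Lc →
                ∃ λ Q → Q ∈ Lc × Same (pos a , z) Q
      meeting {a} {c} {z} {P} {Lc} o s lc with find (complete lc (host-∈ o) (c∈ s) (not-subsumed np))
        where
        c∈ : Same (pos c , z) P → pos c ∈ host o
        c∈ (inj₁ refl) = fst-∈ o
        c∈ (inj₂ refl) = snd-∈ o
      ... | (q₁ , q₂) , Q∈ , (q₁∈ , q₂∈) = (q₁ , q₂) , Q∈ , decide (place s (exact o q₁∈) (λ e → apart-from o′ (inj₁ e))) (place s (exact o q₂∈) (λ e → apart-from o′ (inj₂ e)))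
        where
        o′ = All.lookup (occs lc) Q∈
        place : ∀ {q P} → Same (pos c , z) P → q ∈ pos a ∷ pairClause P → c ≢ atom q → q ≡ pos a ⊎ q ≡ z
        place _           (here e)                   _  = inj₁ e
        place (inj₁ refl) (there (here refl))         c≢ = contradiction refl c≢
        place (inj₂ refl) (there (here e))           _  = inj₂ e
        place (inj₁ refl) (there (there (here e)))   _  = inj₂ e
        place (inj₂ refl) (there (there (here refl))) c≢ = contradiction refl c≢
        q₁≢q₂ : q₁ ≢ q₂
        q₁≢q₂ e with are-apart (pair-fresh o′)
        ... | (n ∷ []) ∷ _ = n (cong atom e)
        decide : q₁ ≡ pos a ⊎ q₁ ≡ z → q₂ ≡ pos a ⊎ q₂ ≡ z → Same (pos a , z) (q₁ , q₂)
        decide (inj₁ refl) (inj₁ refl) = contradiction refl q₁≢q₂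
        decide (inj₁ refl) (inj₂ refl) = inj₁ refl
        decide (inj₂ refl) (inj₁ refl) = inj₂ refl
        decide (inj₂ refl) (inj₂ refl) = contradiction refl q₁≢q₂

      fewer-links : ∀ {a c z P Lc} → Occ S (pos a) P → Same (pos c , z) P → Links S (pos c) Lc →
                    1 + length (avoiding a Lc) ≤ length Lc
      fewer-links o s lc = let (_ , Q∈ , s′) = meeting o s lc in avoiding-fewer Q∈ (touches-same s′)

      -- Two different clauses with both `a` and `c` have different third literals, hence give
      -- different entries under `c`; both touch `a` and vanish.
      much-fewer-links : ∀ {a c z z′ P P′ Lc} → Occ S (pos a) P → Occ S (pos a) P′ → Distinct P P′ →
                         Same (pos c , z) P → Same (pos c , z′) P′ → Links S (pos c) Lc →
                         2 + length (avoiding a Lc) ≤ length Lc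
      much-fewer-links {a} {c} {z} {z′} {P} {P′} {Lc} o o′ d s s′ lc =
        let (_ , Q∈ , t) = meeting o s lc
            (_ , Q∈′ , t′) = meeting o′ s′ lc
        in filter-two (λ R → ¬? (touches? a R)) Q∈ Q∈′ (λ e → d (same-join s (subst (λ y → Same (pos c , y) P′) (sym (align t (subst (Same _) (sym e) t′))) s′)))
             (λ ¬t → ¬t (touches-same t)) (λ ¬t → ¬t (touches-same t′))
        where
        not-a : ∀ {z} → Same (pos c , z) P → pos a ≢ z
        not-a (inj₁ refl) refl = apart-from o (inj₂ refl)
        not-a (inj₂ refl) refl = apart-from o (inj₁ refl)
        align : ∀ {Q} → Same (pos a , z) Q → Same (pos a , z′) Q → z ≡ z′
        align (inj₁ refl) (inj₁ refl) = refl
        align (inj₁ refl) (inj₂ refl) = contradiction refl (not-a s)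
        align (inj₂ refl) (inj₁ refl) = contradiction refl (not-a s)
        align (inj₂ refl) (inj₂ refl) = refl

      module _ (lk : ∀ a → ∃ (Links S (pos a))) {k : ℕ} (le : ∀ {a} → a ∈ free S → length (proj₁ (lk a)) ≤ k) where

        private
          reached : ∀ {a P y} → Occ S (pos a) P → y ∈ pairClause P →
                    ∃ λ c → ∃ λ z → y ≡ pos c × a ≢ c × c ∈ free S × Same (pos c , z) P
          reached {y = neg _} o (here refl)         = contradiction (fst-∈ o) (pure (host-∈ o))
          reached {y = neg _} o (there (here refl)) = contradiction (snd-∈ o) (pure (host-∈ o))
          reached {y = pos c} o (here refl)         = c , _ , refl , (λ e → apart-from o (inj₁ e)) , All.head (are-free (pair-fresh o)) , inj₁ refl
          reached {y = pos c} o (there (here refl)) = c , _ , refl , (λ e → apart-from o (inj₂ e)) , All.head (All.tail (are-free (pair-fresh o))) , inj₂ refl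

        -- A literal shared by two clauses of `a` is some `pos c`, and making `a` true deletes both.
        -- Since `c` had at most `k` clauses, few occurrences are left for branching on it next.
        under-shared : ∀ {a y} → a ∈ free S → 2 ≤ length (holders y (proj₁ (lk a))) →
                       ∃ λ c → c ∈ free (assign (pos a) S) × ∃ λ Ls → Links (assign (pos a) S) (pos c) Ls × 2 + length Ls ≤ k
        under-shared {a} {y} a∈ two = go two (AllPairs.filter⁺ (y ∈ᶜ?_) (distinct (proj₂ (lk a)))) (∈-filter⁻ (y ∈ᶜ?_) {xs = proj₁ (lk a)})
          where
          go : ∀ {A} → 2 ≤ length A → AllPairs Distinct A → (∀ {P} → P ∈ A → P ∈ proj₁ (lk a) × y ∈ pairClause P) →
               ∃ λ c → c ∈ free (assign (pos a) S) × ∃ λ Ls → Links (assign (pos a) S) (pos c) Ls × 2 + length Ls ≤ k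
          go {P ∷ P′ ∷ _} _ ((d ∷ _) ∷ _) inc with inc (here refl) | inc (there (here refl))
          ... | P∈ , y∈ | P∈′ , y∈′ with reached (All.lookup (occs (proj₂ (lk a))) P∈) y∈ | reached (All.lookup (occs (proj₂ (lk a))) P∈′) y∈′
          ... | c , z , refl , a≢c , c∈ , s | _ , z′ , refl , _ , _ , s′ =
            c , free-assign⁺ (pos a) {S} c∈ (≢-sym a≢c) , _ , links-assign a≢c (proj₂ (lk c)) ,
            ≤-trans (much-fewer-links (All.lookup (occs (proj₂ (lk a))) P∈) (All.lookup (occs (proj₂ (lk a))) P∈′) d s s′ (proj₂ (lk c))) (le c∈)
          go {_ ∷ []} (s≤s ()) _ _

        under-single : ∀ {a P} → P ∈ proj₁ (lk a) →
                       ∃ λ c → c ∈ free (assign (pos a) S) × ∃ λ Ls → Links (assign (pos a) S) (pos c) Ls × 1 + length Ls ≤ k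
        under-single {a} {P} P∈ with reached (All.lookup (occs (proj₂ (lk a))) P∈) (here refl)
        ... | c , z , _ , a≢c , c∈ , s = c , free-assign⁺ (pos a) {S} c∈ (≢-sym a≢c) , _ , links-assign a≢c (proj₂ (lk c)) ,
          ≤-trans (fewer-links (All.lookup (occs (proj₂ (lk a))) P∈) s (proj₂ (lk c))) (le c∈)

-- Normalisation and induction

discard : Clause N → State N → State N
discard C S = record S { rest = filter (λ D → ¬? (List-≡-dec _≟_ D C)) (rest S) }

module _ (C : Clause N) {S : State N} where

  discard⁻ : ∀ {D} → D ∈ clauses (discard C S) → D ∈ clauses S
  discard⁻ D∈ with ∈-++⁻ (map pairClause (pairs S)) D∈
  ... | inj₁ p = ∈-++⁺ˡ p
  ... | inj₂ q = rest-∈ {S = S} (proj₁ (∈-filter⁻ _ {xs = rest S} q))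

  -- If `C` was the critical clause of `a`, the clause inside `C` that entails it takes over: its
  -- true literal is true in `C`, hence equals `pos a`.
  good-discard : ∀ {M} → discard C S ⊢ C → Good S M → Good (discard C S) M
  good-discard {M} ent g = good (fix g) sat′ crit′
    where
    sat′ : ∀ {D} → D ∈ clauses (discard C S) → Any (LitTrue M) D
    sat′ D∈ = sat g (discard⁻ D∈)
    crit′ : ∀ {a} → a ∈ free S → a ∈ˢ M → ∃ λ D → D ∈ clauses (discard C S) × Critical M a D
    crit′ {a} a∈ aM with crit g a∈ aM
    ... | D , D∈ , a∈D , only with ∈-++⁻ (map pairClause (pairs S)) D∈
    ...   | inj₁ p = D , ∈-++⁺ˡ p , a∈D , only
    ...   | inj₂ q with List-≡-dec _≟_ D C
    ...     | no D≢C   = D , rest-∈ {S = discard C S} (∈-filter⁺ _ q D≢C) , a∈D , only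
    ...     | yes refl with find (sat′ (member ent))
    ...       | l , l∈ , t with only (within ent l∈) t
    ...         | refl = clause ent , member ent , l∈ , only ∘ within ent

  wf-discard : WF S → WF (discard C S)
  wf-discard w = wf (cover w) (λ D∈ → let p = allProper w (discard⁻ D∈) in proper (in-free p) (apart p) (short p)) (disjoint w)

  discard-shrinks : C ∈ rest S → length (rest (discard C S)) < length (rest S)
  discard-shrinks C∈ = filter-notAll _ (rest S) (Any.map (λ e ¬e → ¬e (sym e)) C∈)

free-unique : ∀ {S : State N} {M M′} → WF S → free S ≡ [] → Good S M → Good S M′ → M ≡ M′
free-unique {S = S} {M} {M′} w none-free g g′ = ⊆-antisym (λ {a} → agree g g′ a) (λ {a} → agree g′ g a)
  where
  agree : ∀ {M M′} → Good S M → Good S M′ → ∀ a → a ∈ˢ M → a ∈ˢ M′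
  agree {M} {M′} g g′ a a∈ with cover w a
  ... | inj₁ a∈f with subst (a ∈_) none-free a∈f
  ...   | ()
  agree {M} {M′} g g′ a a∈ | inj₂ l with find l
  ... | pos _ , l∈ , refl = All.lookup (fix g′) l∈
  ... | neg _ , l∈ , refl = contradiction a∈ (All.lookup (fix g) l∈)

module Main {b : ℕ} (ih : IH N b) where
  open Step ih

  module _ {S : State N} (w : WF S) (S≤ : length (free S) ≤ b) (three : Three S) (np : NoPairs S) where
    open NoPair ih

    private
      L : ∀ l → ∃ (Links S l)
      L = find-links w three

      P : Fin N → List (Pair N)
      P a = proj₁ (L (pos a))

      first : ∀ {A : Set} {xs : List A} → 1 ≤ length xs → ∃ λ x → x ∈ xs
      first {xs = x ∷ _} _ = x , here refl

    module _ (pure : ∀ {C a} → C ∈ rest S → ¬ neg a ∈ C) {a} (a∈ : a ∈ free S) where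

      private
        S′ : State N
        S′ = assign (pos a) S

        f₁ : Fresh S (pos a ∷ [])
        f₁ = fresh (a∈ ∷ []) ([] ∷ [])

        under-true : ∀ {c} c′ → Count S′ c → Fits c 1 0 0 c′ → CountUnder S (pos a ∷ []) c′
        under-true c′ cnt check = count-under c′ (pos a ∷ []) w f₁ (no-drop np _) cnt check

        S′≤ : length (free S′) ≤ b
        S′≤ = ≤-trans (n≤1+n _) (small-assign* (pos a) [] S≤ f₁)

        few₁ : ∀ {c Ls} → c ∈ free S′ → Links S′ (pos c) Ls → length Ls ≤ 1 → Count S′ 8137
        few₁ = count-one-link (wf-assign (pos a) w) S′≤ (no-pairs-assign np (pos a))

        few₂ : ∀ {c Ls} → c ∈ free S′ → Links S′ (pos c) Ls → length Ls ≤ 2 → Count S′ 9182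
        few₂ = count-two-links (wf-assign (pos a) w) S′≤ (no-pairs-assign np (pos a))

        La = proj₂ (L (pos a))

        sharing : AllPairs Disjoint (P a) ⊎ (∃ λ y → 2 ≤ length (holders y (P a)))
        sharing = disjoint-or-shared (P a) (occ-consistent w S≤ np pure (occs La))

      -- If the links are disjoint, `a` false creates four pairs and the total is 1/τ + x⁴/τ.
      -- Otherwise some `c` shares two clauses with `a` and keeps at most two once `a` is true, so
      -- the weaker coefficient of four overlapping links is compensated in the true branch.
      bounded-four : (∀ {c} → c ∈ free S → length (P c) ≤ 4) → length (P a) ≡ 4 → Bounded S
      bounded-four le eq with sharing
      ... | inj₁ dis = Card-⊎ (plain-split w S≤ np a)
        (under-true 5989 (ih (wf-assign (pos a) w) (small-assign* (pos a) [] S≤ f₁)) (fits _))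
        (under-disjoint w S≤ np pure {c = 3987} a∈ (occs La) dis (subst (λ n → Fits (disjointWeight n) 1 0 0 3987) (sym eq) (fits _))) _
      ... | inj₂ (y , two) with under-shared w S≤ np pure (λ c → L (pos c)) le a∈ two
      ...   | c , c∈ , Ls , ls , s≤s (s≤s ≤2) = Card-⊎ (plain-split w S≤ np a)
        (under-true 5499 (few₂ c∈ ls ≤2) (fits _))
        (under-consistent w S≤ np pure {c = 4295} a∈ (≤-trans (≤-reflexive eq) (n≤1+n 4)) (occs La) (distinct La)
          (subst (λ n → Fits (pairlessWeight n) 1 0 0 4295) (sym eq) (fits _))) _

      -- Three links are too few to pay for 5989 on the true side, which therefore has to gain as
      -- well: every atom `c` in a clause of `a` keeps at most two clauses. If the links overlap,
      -- even 5499 is too much, but then some `c` keeps at most one.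
      bounded-three : (∀ {c} → c ∈ free S → length (P c) ≤ 3) → length (P a) ≡ 3 → Bounded S
      bounded-three le eq with sharing
      ... | inj₁ dis with first (≤-trans (s≤s z≤n) (≤-reflexive (sym eq)))
      ...   | Q , Q∈ with under-single w S≤ np pure (λ c → L (pos c)) le Q∈
      ...     | c , c∈ , Ls , ls , s≤s ≤2 = Card-⊎ (plain-split w S≤ np a)
        (under-true 5499 (few₂ c∈ ls ≤2) (fits _))
        (under-disjoint w S≤ np pure {c = 4414} a∈ (occs La) dis (subst (λ n → Fits (disjointWeight n) 1 0 0 4414) (sym eq) (fits _))) _
      bounded-three le eq | inj₂ (y , two) with under-shared w S≤ np pure (λ c → L (pos c)) le a∈ two
      ...   | c , c∈ , Ls , ls , s≤s (s≤s ≤1) = Card-⊎ (plain-split w S≤ np a)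
        (under-true 4873 (few₁ c∈ ls ≤1) (fits _))
        (under-consistent w S≤ np pure {c = 4526} a∈ (≤-trans (≤-reflexive eq) (s≤s (s≤s (s≤s z≤n)))) (occs La) (distinct La)
          (subst (λ n → Fits (pairlessWeight n) 1 0 0 4526) (sym eq) (fits _))) _

    bounded-regular : (∀ {C a} → C ∈ rest S → ¬ neg a ∈ C) → (∀ {a} → a ∈ free S → 3 ≤ length (P a)) →
                      (∀ {a} → a ∈ free S → length (P a) ≤ 4) → ∀ {a} → a ∈ free S → Bounded S
    bounded-regular pure ≥3 ≤4 {a} a∈ with any? (λ a → length (P a) ≟ⁿ 4) (free S)
    ... | yes four = let (_ , c∈ , eq) = find four in bounded-four pure c∈ ≤4 eq
    ... | no ¬four = bounded-three pure a∈ ≤3 (≤-antisym (≤3 a∈) (≥3 a∈))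
      where
      ≤3 : ∀ {c} → c ∈ free S → length (P c) ≤ 3
      ≤3 c∈ with m≤n⇒m<n∨m≡n (≤4 c∈)
      ... | inj₁ (s≤s le) = le
      ... | inj₂ eq = contradiction (lose c∈ eq) ¬four

    private
      at-least-five : ∀ {a Ls} → (∀ {C a} → C ∈ rest S → ¬ neg a ∈ C) → a ∈ free S → Links S (pos a) Ls → 5 ≤ length Ls → Bounded S
      at-least-five {Ls = _ ∷ _ ∷ _ ∷ _ ∷ _ ∷ _} pure a∈ ls _ = bounded-five w S≤ np pure a∈ ls
      at-least-five {Ls = []} _ _ _ ()
      at-least-five {Ls = _ ∷ []} _ _ _ (s≤s ())
      at-least-five {Ls = _ ∷ _ ∷ []} _ _ _ (s≤s (s≤s ()))
      at-least-five {Ls = _ ∷ _ ∷ _ ∷ []} _ _ _ (s≤s (s≤s (s≤s ())))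
      at-least-five {Ls = _ ∷ _ ∷ _ ∷ _ ∷ []} _ _ _ (s≤s (s≤s (s≤s (s≤s ()))))

      mixed : ∀ {a Ls Ls′} → a ∈ free S → Links S (pos a) Ls → 3 ≤ length Ls → Links S (neg a) Ls′ → 1 ≤ length Ls′ → Bounded S
      mixed {Ls = _ ∷ _ ∷ _ ∷ _} {_ ∷ _} a∈ ls _ ls′ _ = bounded-mixed w S≤ np a∈ ls ls′
      mixed {Ls = []} _ _ () _ _
      mixed {Ls = _ ∷ []} _ _ (s≤s ()) _ _
      mixed {Ls = _ ∷ _ ∷ []} _ _ (s≤s (s≤s ())) _ _

      no-links⇒absent : ∀ {l Ls C} → Links S l Ls → ¬ 1 ≤ length Ls → C ∈ rest S → ¬ l ∈ C
      no-links⇒absent {Ls = []} ls _ C∈ l∈ with complete ls C∈ l∈ (not-subsumed np)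
      ... | ()
      no-links⇒absent {Ls = _ ∷ _} _ n _ _ = n (s≤s z≤n)

    bounded-no-pairs : ∀ {a} → a ∈ free S → Bounded S
    bounded-no-pairs a∈ with any? (λ a → length (P a) ≤? 2) (free S)
    ... | yes few = let (c , c∈ , le) = find few in Card-mono _ (count-two-links w S≤ np c∈ (proj₂ (L (pos c))) le)
    ... | no ¬few with any? (λ a → 1 ≤? length (proj₁ (L (neg a)))) (free S)
    ...   | yes some = let (c , c∈ , le) = find some in
        mixed c∈ (proj₂ (L (pos c))) (≰⇒> λ le → ¬few (lose c∈ le)) (proj₂ (L (neg c))) le
    ...   | no ¬some = split (any? (λ a → 5 ≤? length (P a)) (free S))
      where
      pure : ∀ {C a} → C ∈ rest S → ¬ neg a ∈ C
      pure {C} {a} C∈ n∈ = no-links⇒absent (proj₂ (L (neg a)))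
        (λ le → ¬some (lose (in-free (allProper w (rest-∈ {S = S} C∈)) n∈) le)) C∈ n∈
      split : Dec (Any (λ a → 5 ≤ length (P a)) (free S)) → Bounded S
      split (yes many) = let (c , c∈ , le) = find many in at-least-five pure c∈ (proj₂ (L (pos c))) le
      split (no ¬many) = bounded-regular pure (λ c∈ → ≰⇒> λ le → ¬few (lose c∈ le))
        (λ c∈ → ≤-pred (≰⇒> λ le → ¬many (lose c∈ le))) a∈

  private
    all-three : ∀ {S : State N} → WF S → ¬ Any (λ C → length C ≤ 2) (rest S) → Three S
    all-three {S} w none C∈ = ≤-antisym (short (allProper w (rest-∈ {S = S} C∈))) (≰⇒> λ le → none (lose C∈ le))

    bounded-three-clauses : ∀ {S : State N} → WF S → length (free S) ≤ b → Three S → Bounded S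
    bounded-three-clauses {state _ _ (_ ∷ _) _} w S≤ three = WithPair.bounded-pair ih w S≤ three (fwd (here refl))
    bounded-three-clauses {state _ (_ ∷ _) [] _} w S≤ three = bounded-no-pairs w S≤ three (no-pairs refl) (here refl)
    bounded-three-clauses {state _ [] [] _} w S≤ three = Card-prop (free-unique w refl)

    paired? : ∀ (S : State N) l m → Dec (Paired S l m)
    paired? S l m = map′ (λ { (inj₁ p) → fwd p ; (inj₂ p) → bwd p }) (λ { (fwd p) → inj₁ p ; (bwd p) → inj₂ p })
      (any? (≡-dec _≟_ _≟_ (l , m)) (pairs S) ⊎-dec any? (≡-dec _≟_ _≟_ (m , l)) (pairs S))

  -- Normalising short clauses shrinks `rest` without assigning atoms, so it has its own induction
  -- on `r` inside the one on free atoms. A 2-clause off all pairs is promoted to a pair, a copy of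
  -- a pair is discarded, and one that meets a pair is branched on.
  bounded-step : ∀ r {S : State N} → length (rest S) ≤ r → WF S → length (free S) ≤ b → Bounded S
  bounded-step r {S} r≤ w S≤ with any? (λ C → length C ≤? 2) (rest S)
  ... | no none = bounded-three-clauses w S≤ (all-three w none)
  ... | yes p with find p
  ...   | [] , C∈ , _ = Card-∅ λ g → absurd (sat g (rest-∈ {S = S} C∈))
    where
    absurd : ∀ {M : Subset N} → ¬ Any (LitTrue M) []
    absurd ()
  ...   | l ∷ [] , C∈ , _ = Card-mono _ (Card-⊆ unit (leaf₁ w S≤ 6630 l (in-free (allProper w (rest-∈ {S = S} C∈)) (here refl)) (fits _)))
    where
    unit : ∀ {M} → Good S M → Under S (l ∷ []) M
    unit g with sat g (rest-∈ {S = S} C∈)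
    ... | here t = g , t ∷ []
  ...   | l ∷ m ∷ _ ∷ _ , _ , s≤s (s≤s ())
  bounded-step zero r≤ w S≤ | yes p | l ∷ m ∷ [] , C∈ , _ with rest-empty r≤ C∈
    where
    rest-empty : ∀ {A : Set} {xs : List A} {x} → length xs ≤ 0 → ¬ x ∈ xs
    rest-empty {xs = []} _ ()
  ... | ()
  bounded-step (suc r) {S} r≤ w S≤ | yes p | C@(l ∷ m ∷ []) , C∈ , _ with paired? S l m
  ... | yes pd = Card-⊆ (good-discard C (discharge pd)) (bounded-step r shorter (wf-discard C w) S≤)
    where
    shorter = ≤-pred (≤-trans (discard-shrinks C {S} C∈) r≤)
    discharge : Paired S l m → discard C S ⊢ C
    discharge (fwd q) = paired-⊢ (fwd q)
    discharge (bwd q) = paired-⊢ (bwd q)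
  ... | no ¬pd = from-class (classify k)
    where
    S⁺ : State N
    S⁺ = addPair (l , m) S
    prop = allProper w (rest-∈ {S = S} C∈)
    lm-apart : atom l ≢ atom m
    lm-apart with apart prop
    ... | (n ∷ []) ∷ _ = n
    k : Link S (l , m)
    k = link (by (rest-∈ {S = S} C∈) (λ z → z))
      (fresh (in-free prop (here refl) ∷ in-free prop (there (here refl)) ∷ []) ((lm-apart ∷ []) ∷ [] ∷ [])) ¬pd
    from-class : Class S (l , m) → Bounded S
    from-class (negative k′ q) = Card-mono _ (count-negative w S≤ k′ q)
    from-class (positive {y} _ k′ q z≢d) = count-positive w S≤ 6630 k′ q z≢d
      (ih (wf-assign y w) (small-assign* {S = S} y [] S≤ (fresh (link-free₁ k′ ∷ []) ([] ∷ [])))) (fits _) _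
    -- The pair is added before the clause is discarded from `rest`, so that it entails what is
    -- dropped.
    from-class (isolated u v) = count-addPair k (Card-⊆ (good-discard C {S⁺} (by (here refl) (λ z → z)))
      (bounded-step r (≤-pred (≤-trans (discard-shrinks C {S⁺} C∈) r≤)) (wf-discard C (wf-addPair k w u v)) S≤)) (fits _)

bounded : ∀ b → IH N b
bounded zero    _ ()
bounded (suc b) {S} w (s≤s S≤) = Main.bounded-step (bounded b) (length (rest S)) ≤-refl w S≤

-- Theories and programs

apart-clause : {C : Clause N} → WellFormedClause C → Apart C
apart-clause (u , c) = go u c
  where
  go : ∀ {C : Clause N} → Unique C → (∀ a → ¬ (pos a ∈ C × neg a ∈ C)) → Apart C
  go []       _ = []
  go {C = l ∷ C} (n ∷ u) c = All.tabulate (λ {m} m∈ e → [ All.lookup n m∈ , complementary m m∈ ]′ (atom-≡ l m e))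
    ∷ go u λ a (p , q) → c a (there p , there q)
    where
    complementary : ∀ m → m ∈ C → l ≢ opp m
    complementary (pos a) m∈ e = c a (there m∈ , here (sym e))
    complementary (neg a) m∈ e = c a (here (sym e) , there m∈)

initial : Theory N → State N
initial {N} T = state [] (allFin N) [] T

wf-initial : ∀ {T : Theory N} → IsCNF 3 T → WF (initial T)
wf-initial cnf = wf (λ a → inj₁ (∈-allFin a))
  (λ C∈ → let (w , s) = All.lookup cnf C∈ in proper (λ _ → ∈-allFin _) (apart-clause w) s) []

-- If a true `a` had no critical clause, every clause would have another true literal. Removing `a`
-- keeps all of these true, negative ones included, so `M - a` would be a smaller model.
good-initial : ∀ {T : Theory N} {M} → IsMinimalModel T M → Good (initial T) M
good-initial {T = T} {M} (model , minimal) = good [] (All.lookup model) crit′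
  where
  ∃other? : ∀ a (C : Clause _) → Dec (Any (λ l → LitTrue M l × l ≢ pos a) C)
  ∃other? a = any? λ l → holds? l ×-dec ¬? (l ≟ pos a)
    where
    holds? : ∀ l → Dec (LitTrue M l)
    holds? l with holds-or-opp M l
    ... | inj₁ t = yes t
    ... | inj₂ f = no λ t → not-both l t f
  survives : ∀ {a} → a ∈ˢ M → ∀ {l} → LitTrue M l × l ≢ pos a → LitTrue (M - a) l
  survives a∈ {pos b} (t , l≢) = x∈p∧x≢y⇒x∈p-y t λ e → l≢ (cong pos e)
  survives a∈ {neg b} (t , _)  = λ b∈ → t (proj₁ (x∈p⇒p-x⊂p a∈) b∈)
  crit′ : ∀ {a} → a ∈ allFin _ → a ∈ˢ M → ∃ λ C → C ∈ T × Critical M a C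
  crit′ {a} _ a∈ with any? (λ C → ¬? (∃other? a C)) T
  ... | no  all   = ⊥-elim (minimal (M - a) (x∈p⇒p-x⊂p a∈) (All.tabulate λ {C} C∈ → other C∈ (∃other? a C)))
    where
    other : ∀ {C} → C ∈ T → Dec (Any (λ l → LitTrue M l × l ≢ pos a) C) → Any (LitTrue (M - a)) C
    other _  (yes o) = Any.map (λ {l} → survives a∈ {l}) o
    other C∈ (no ¬o) = contradiction (lose C∈ ¬o) all
  ... | yes lone with find lone
  ... | C , C∈ , ¬o with find (All.lookup model C∈)
  ... | l , l∈ , t with l ≟ pos a
  ...   | no l≢    = contradiction (lose l∈ (t , l≢)) ¬o
  ...   | yes refl = C , C∈ , l∈ , only
    where
    only : ∀ {m} → m ∈ C → LitTrue M m → m ≡ pos a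
    only {m} m∈ t with m ≟ pos a
    ... | yes e = e
    ... | no m≢ = contradiction (lose m∈ (t , m≢)) ¬o

count-minimal-models : ∀ {T : Theory N} → IsCNF 3 T → ∀ {ms} → Unique ms → All (IsMinimalModel T) ms →
                       length ms * 100 ^ N ≤ 167 ^ N
count-minimal-models {N} {T} cnf {ms} u all = subst (λ n → length ms * 100 ^ n ≤ 167 ^ n) (length-tabulate {n = N} (λ a → a))
  (strip 10000 (length ms) (100 ^ length (allFin N)) (167 ^ length (allFin N))
    (Card.bound (bounded (suc (length (allFin N))) (wf-initial cnf) ≤-refl) u (All.map good-initial all)))
  where
  reorder : ∀ D L A → L * (D * (A * 1)) ≡ D * (L * A)
  reorder = solve-∀
  strip : ∀ D .{{_ : NonZero D}} L A B → L * (D * (A * 1)) ≤ D * (B * 1) → L * A ≤ B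
  strip D L A B le = *-cancelˡ-≤ D (≤-trans (≤-reflexive (sym (reorder D L A))) (≤-trans le (≤-reflexive (cong (D *_) (*-identityʳ B)))))

-- Programs read as clausal theories

ruleClause : DClause N → Clause N
ruleClause C = map pos (dhead C) ++ map neg (dposBody C) ++ map pos (dnegBody C)

Tautology : Clause N → Set
Tautology C = Any (λ l → opp l ∈ C) C

tautology? : (C : Clause N) → Dec (Tautology C)
tautology? C = any? (λ l → any? (opp l ≟_) C) C

-- A rule may repeat an atom or mention it on both sides, which a well-formed clause may not.
-- Deduplicating literals and dropping tautologies repairs this without changing the models.
ruleTheory : DProgram N → Theory N
ruleTheory P = filter (λ C → ¬? (tautology? C)) (map (λ C → deduplicate _≟_ (ruleClause C)) P)

ruleTheory-cnf : ∀ {t} {P : DProgram N} → IsDisjunctiveProgram t P → IsCNF t (ruleTheory P)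
ruleTheory-cnf {t = t} {P} ok = All.tabulate λ C∈ → convert (∈-filter⁻ _ {xs = map _ P} C∈)
  where
  size : ∀ (C : DClause _) → length (ruleClause C) ≡ length (dhead C) + length (dposBody C) + length (dnegBody C)
  size (h ⇐ᵈ b ,not c) = trans (length-++ (map pos h)) (trans (cong₂ _+_ (length-map pos h)
    (trans (length-++ (map neg b)) (cong₂ _+_ (length-map neg b) (length-map pos c)))) (sym (+-assoc (length h) (length b) (length c))))
  convert : ∀ {C} → C ∈ map (λ C → deduplicate _≟_ (ruleClause C)) P × ¬ Tautology C → WellFormedClause C × length C ≤ t
  convert (C∈ , ¬taut) with ∈-map⁻ _ C∈
  ... | R , R∈ , refl = (deduplicate-! _≟_ (ruleClause R) , λ a (p , n) → ¬taut (lose p n)) ,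
    ≤-trans (length-deduplicate _≟_ (ruleClause R)) (≤-trans (≤-reflexive (size R)) (proj₂ (All.lookup ok R∈)))

satisfies-rules : ∀ {P : DProgram N} {M} → IsModel (ruleTheory P) M → ∀ {R} → R ∈ P → Any (LitTrue M) (ruleClause R)
satisfies-rules {P = P} {M} model {R} R∈ with tautology? (deduplicate _≟_ (ruleClause R))
... | no ¬taut = let (l , l∈ , t) = find (All.lookup model (∈-filter⁺ (λ C → ¬? (tautology? C)) (∈-map⁺ _ R∈) ¬taut)) in
  lose (∈-deduplicate⁻ _≟_ (ruleClause R) l∈) t
... | yes taut with find taut
... | l , l∈ , o∈ with holds-or-opp M l
...   | inj₁ t = lose (∈-deduplicate⁻ _≟_ (ruleClause R) l∈) t
...   | inj₂ f = lose (∈-deduplicate⁻ _≟_ (ruleClause R) o∈) f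

module _ {P : DProgram N} {M : Subset N} where

  private
    unblocked? : (R : DClause N) → Dec (All (λ c → ¬ c ∈ˢ M) (dnegBody R))
    unblocked? R = All.all? (λ c → ¬? (c ∈ˢ? M)) (dnegBody R)

  reduct⁺ : ∀ {R} → R ∈ P → All (λ c → ¬ c ∈ˢ M) (dnegBody R) → (dhead R , dposBody R) ∈ DReduct P M
  reduct⁺ R∈ u = ∈-map⁺ (λ C → dhead C , dposBody C) (∈-filter⁺ unblocked? R∈ u)

  reduct⁻ : ∀ {h b} → (h , b) ∈ DReduct P M → ∃ λ R → R ∈ P × All (λ c → ¬ c ∈ˢ M) (dnegBody R) × h ≡ dhead R × b ≡ dposBody R
  reduct⁻ x∈ with ∈-map⁻ (λ C → dhead C , dposBody C) x∈
  ... | R , R∈′ , refl = let (R∈ , u) = ∈-filter⁻ unblocked? {xs = P} R∈′ in R , R∈ , u , refl , refl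

  -- A rule kept in the reduct has no negated atom in `M`, hence none in a subset of `M`. So a
  -- smaller model of the clausal theory would be a smaller model of the reduct.
  answer-set⇒minimal : IsAnswerSet P M → IsMinimalModel (ruleTheory P) M
  answer-set⇒minimal (model , minimal) = All.tabulate (λ C∈ → satisfied (∈-filter⁻ _ {xs = map _ P} C∈)) , least
    where
    sat-rule : ∀ {R} → R ∈ P → Any (LitTrue M) (ruleClause R)
    sat-rule {R} R∈ with unblocked? R | All.all? (_∈ˢ? M) (dposBody R)
    ... | yes u | yes b = Any.++⁺ˡ (Any.map⁺ (All.lookup model (reduct⁺ R∈ u) b))
    ... | yes u | no ¬b = Any.++⁺ʳ (map pos (dhead R)) (Any.++⁺ˡ (Any.map⁺ (All.¬All⇒Any¬ (_∈ˢ? M) _ ¬b)))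
    ... | no ¬u | _     = Any.++⁺ʳ (map pos (dhead R)) (Any.++⁺ʳ (map neg (dposBody R))
      (Any.map⁺ (Any.map (λ {c} ¬¬c → decidable-stable (c ∈ˢ? M) ¬¬c) (All.¬All⇒Any¬ (λ c → ¬? (c ∈ˢ? M)) _ ¬u))))
    satisfied : ∀ {C} → C ∈ map (λ R → deduplicate _≟_ (ruleClause R)) P × ¬ Tautology C → Any (LitTrue M) C
    satisfied (C∈ , _) with ∈-map⁻ _ C∈
    ... | R , R∈ , refl = let (l , l∈ , t) = find (sat-rule R∈) in lose (∈-deduplicate⁺ _≟_ l∈) t
    least : ∀ N′ → N′ ⊂ˢ M → ¬ IsModel (ruleTheory P) N′
    least N′ N′⊂M modelN = minimal N′ N′⊂M (All.tabulate λ x∈ → derive (reduct⁻ x∈))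
      where
      derive : ∀ {h b} → (∃ λ R → R ∈ P × All (λ c → ¬ c ∈ˢ M) (dnegBody R) × h ≡ dhead R × b ≡ dposBody R) →
               All (_∈ˢ N′) b → Any (_∈ˢ N′) h
      derive (R , R∈ , u , refl , refl) body with Any.++⁻ (map pos (dhead R)) (satisfies-rules {P = P} modelN R∈)
      ... | inj₁ h = Any.map⁻ h
      ... | inj₂ r with Any.++⁻ (map neg (dposBody R)) r
      ...   | inj₁ b = let (_ , b∈ , b∉) = find (Any.map⁻ b) in contradiction (All.lookup body b∈) b∉
      ...   | inj₂ c = let (_ , c∈ , t) = find (Any.map⁻ c) in contradiction (proj₁ N′⊂M t) (All.lookup u c∈)

disjunctive : NProgram N → DProgram N
disjunctive = map λ C → (head C ∷ []) ⇐ᵈ posBody C ,not negBody C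

disjunctive-ok : ∀ {t} {P : NProgram N} → IsNormalProgram t P → IsDisjunctiveProgram t (disjunctive P)
disjunctive-ok ok = All.map⁺ (All.map (s≤s z≤n ,_) ok)

module _ {P : NProgram N} {M : Subset N} where

  private
    unblocked? : (R : NClause N) → Dec (All (λ c → ¬ c ∈ˢ M) (negBody R))
    unblocked? R = All.all? (λ c → ¬? (c ∈ˢ? M)) (negBody R)

    horn⇒disjunctive : ∀ {N′} → IsHornModel (NReduct P M) N′ → IsPosDModel (DReduct (disjunctive P) M) N′
    horn⇒disjunctive {N′} model = All.tabulate λ x∈ → step (reduct⁻ {P = disjunctive P} x∈)
      where
      step : ∀ {h b} → (∃ λ R → R ∈ disjunctive P × All (λ c → ¬ c ∈ˢ M) (dnegBody R) × h ≡ dhead R × b ≡ dposBody R) →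
             All (_∈ˢ N′) b → Any (_∈ˢ N′) h
      step (_ , R∈ , u , refl , refl) body with ∈-map⁻ _ R∈
      ... | C , C∈ , refl = here (All.lookup model (∈-map⁺ (λ C → head C , posBody C) (∈-filter⁺ unblocked? C∈ u)) body)

    disjunctive⇒horn : ∀ {N′} → IsPosDModel (DReduct (disjunctive P) M) N′ → IsHornModel (NReduct P M) N′
    disjunctive⇒horn {N′} model = All.tabulate λ x∈ → step (∈-map⁻ (λ C → head C , posBody C) x∈)
      where
      step : ∀ {h b} → (∃ λ C → C ∈ filter unblocked? P × (h , b) ≡ (head C , posBody C)) → All (_∈ˢ N′) b → h ∈ˢ N′
      step (C , C∈′ , refl) body with ∈-filter⁻ unblocked? {xs = P} C∈′
      ... | C∈ , u with All.lookup model (reduct⁺ {P = disjunctive P} (∈-map⁺ _ C∈) u) body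
      ... | here t = t

  stable⇒answer-set : IsStableModel P M → IsAnswerSet (disjunctive P) M
  stable⇒answer-set (model , least) = horn⇒disjunctive model ,
    λ N′ (_ , x , x∈M , x∉N′) modelN → x∉N′ (least N′ (disjunctive⇒horn modelN) x∈M)

-- The constant c

private
  *-^ : ∀ m n k → (m * n) ^ k ≡ m ^ k * n ^ k
  *-^ m n zero    = refl
  *-^ m n (suc k) = trans (cong (m * n *_) (*-^ m n k)) (swap-inner m n (m ^ k) (n ^ k))
    where
    swap-inner : ∀ a b c d → (a * b) * (c * d) ≡ (a * c) * (b * d)
    swap-inner = solve-∀

  power-bound : ∀ {a b c d T Q p q} i j → a * T ≤ b * Q → c * p ≤ d * q →
                (a ^ i * c ^ j) * (T ^ i * p ^ j) ≤ (b ^ i * d ^ j) * (Q ^ i * q ^ j)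
  power-bound {a} {b} {c} {d} {T} {Q} {p} {q} i j ≤₁ ≤₂ = begin
    (a ^ i * c ^ j) * (T ^ i * p ^ j) ≡⟨ exchange (a ^ i) (c ^ j) (T ^ i) (p ^ j) ⟩
    (a ^ i * T ^ i) * (c ^ j * p ^ j) ≡⟨ cong₂ _*_ (sym (*-^ a T i)) (sym (*-^ c p j)) ⟩
    (a * T) ^ i * (c * p) ^ j         ≤⟨ *-mono-≤ (^-monoˡ-≤ i ≤₁) (^-monoˡ-≤ j ≤₂) ⟩
    (b * Q) ^ i * (d * q) ^ j         ≡⟨ cong₂ _*_ (*-^ b Q i) (*-^ d q j) ⟩
    (b ^ i * Q ^ i) * (d ^ j * q ^ j) ≡⟨ exchange (b ^ i) (Q ^ i) (d ^ j) (q ^ j) ⟩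
    (b ^ i * d ^ j) * (Q ^ i * q ^ j) ∎
    where
    open ≤-Reasoning
    exchange : ∀ a b c d → (a * b) * (c * d) ≡ (a * c) * (b * d)
    exchange = solve-∀

  -- Relative to `T ^ (i + i′) * p ^ (j + j′)`, the summand on the right is (q⁴/T)^i (q/p)^j. The
  -- upper bounds b/a on T/q⁴ and d/c on p/q bound this ratio from below; α/D is that bound rounded
  -- down.
  term-bound : ∀ {a b c d T p q} .{{_ : NonZero b}} .{{_ : NonZero d}} i j i′ j′ α D →
               a * T ≤ b * q ^ 4 → c * p ≤ d * q → α * (b ^ i * d ^ j) ≤ D * (a ^ i * c ^ j) →
               α * (T ^ (i + i′) * p ^ (j + j′)) ≤ D * (q ^ (4 * i + j) * T ^ i′ * p ^ j′)
  term-bound {a} {b} {c} {d} {T} {p} {q} i j i′ j′ α D ≤₁ ≤₂ ≤α =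
    *-cancelʳ-≤ _ _ (b ^ i * d ^ j) {{m*n≢0 _ _ {{m^n≢0 b i}} {{m^n≢0 d j}}}} (begin
      α * (T ^ (i + i′) * p ^ (j + j′)) * B
        ≡⟨ cong (λ x → α * x * B) (cong₂ _*_ (^-distribˡ-+-* T i i′) (^-distribˡ-+-* p j j′)) ⟩
      α * ((T ^ i * T ^ i′) * (p ^ j * p ^ j′)) * B
        ≡⟨ e₁ α (T ^ i) (T ^ i′) (p ^ j) (p ^ j′) B ⟩
      α * B * ((T ^ i * p ^ j) * (T ^ i′ * p ^ j′))   ≤⟨ *-monoˡ-≤ _ ≤α ⟩
      D * A * ((T ^ i * p ^ j) * (T ^ i′ * p ^ j′))   ≡⟨ e₂ D A (T ^ i * p ^ j) (T ^ i′ * p ^ j′) ⟩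
      D * (T ^ i′ * p ^ j′) * (A * (T ^ i * p ^ j))   ≤⟨ *-monoʳ-≤ (D * (T ^ i′ * p ^ j′)) (power-bound {a} {b} {c} {d} i j ≤₁ ≤₂) ⟩
      D * (T ^ i′ * p ^ j′) * (B * ((q ^ 4) ^ i * q ^ j))
        ≡⟨ cong (λ x → D * (T ^ i′ * p ^ j′) * (B * x)) (trans (cong (_* q ^ j) (^-*-assoc q 4 i)) (sym (^-distribˡ-+-* q (4 * i) j))) ⟩
      D * (T ^ i′ * p ^ j′) * (B * q ^ (4 * i + j))   ≡⟨ e₃ D (T ^ i′) (p ^ j′) B (q ^ (4 * i + j)) ⟩
      D * (q ^ (4 * i + j) * T ^ i′ * p ^ j′) * B     ∎)
    where
    open ≤-Reasoning
    A = a ^ i * c ^ j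
    B = b ^ i * d ^ j
    e₁ : ∀ α t t′ p p′ B → α * ((t * t′) * (p * p′)) * B ≡ α * B * ((t * p) * (t′ * p′))
    e₁ = solve-∀
    e₂ : ∀ D A x y → D * A * (x * y) ≡ D * y * (A * x)
    e₂ = solve-∀
    e₃ : ∀ D t p B Q → D * (t * p) * (B * Q) ≡ D * (Q * t * p) * B
    e₃ = solve-∀

  -- Here d/c is a rational above the fourth root of b/a, and comparing fourth powers shows that p/q
  -- cannot exceed it.
  root-bound : ∀ {a b c d p q} → a * p ^ 4 ≤ b * q ^ 4 → b * c ^ 4 < a * d ^ 4 → 0 < q → c * p ≤ d * q
  root-bound {a} {b} {c} {d} {p} {q} le lt 0<q with c * p ≤? d * q
  ... | yes r = r
  ... | no ¬r = contradiction
    (*-cancelʳ-≤ (a * d ^ 4) (b * c ^ 4) (q ^ 4) {{m^n≢0 q 4 {{>-nonZero 0<q}}}} (begin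
      a * d ^ 4 * q ^ 4     ≡⟨ trans (*-assoc a (d ^ 4) (q ^ 4)) (cong (a *_) (sym (*-^ d q 4))) ⟩
      a * (d * q) ^ 4       ≤⟨ *-monoʳ-≤ a (^-monoˡ-≤ 4 (<⇒≤ (≰⇒> ¬r))) ⟩
      a * (c * p) ^ 4       ≡⟨ trans (cong (a *_) (*-^ c p 4)) (exchange a (c ^ 4) (p ^ 4)) ⟩
      a * p ^ 4 * c ^ 4     ≤⟨ *-monoˡ-≤ (c ^ 4) le ⟩
      b * q ^ 4 * c ^ 4     ≡⟨ exchange′ b (q ^ 4) (c ^ 4) ⟩
      b * c ^ 4 * q ^ 4     ∎))
    (<⇒≱ lt)
    where
    open ≤-Reasoning
    exchange : ∀ a x y → a * (x * y) ≡ a * y * x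
    exchange = solve-∀
    exchange′ : ∀ a x y → a * x * y ≡ a * y * x
    exchange′ = solve-∀

  sum-bound : ∀ {R D t₁ t₂ t₃ t₄} α₁ α₂ α₃ α₄ → α₁ * R ≤ D * t₁ → α₂ * R ≤ D * t₂ → α₃ * R ≤ D * t₃ → α₄ * R ≤ D * t₄ →
              t₁ + t₂ + 2 * t₃ + t₄ ≤ R → (α₁ + α₂ + 2 * α₃ + α₄) * R ≤ D * R
  sum-bound {R} {D} {t₁} {t₂} {t₃} {t₄} α₁ α₂ α₃ α₄ ≤₁ ≤₂ ≤₃ ≤₄ le = begin
    (α₁ + α₂ + 2 * α₃ + α₄) * R                       ≡⟨ e₁ α₁ α₂ α₃ α₄ R ⟩
    α₁ * R + α₂ * R + 2 * (α₃ * R) + α₄ * R           ≤⟨ +-mono-≤ (+-mono-≤ (+-mono-≤ ≤₁ ≤₂) (*-monoʳ-≤ 2 ≤₃)) ≤₄ ⟩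
    D * t₁ + D * t₂ + 2 * (D * t₃) + D * t₄           ≡⟨ e₂ D t₁ t₂ t₃ t₄ ⟩
    D * (t₁ + t₂ + 2 * t₃ + t₄)                       ≤⟨ *-monoʳ-≤ D le ⟩
    D * R                                             ∎
    where
    open ≤-Reasoning
    e₁ : ∀ a b c d R → (a + b + 2 * c + d) * R ≡ a * R + b * R + 2 * (c * R) + d * R
    e₁ = solve-∀
    e₂ : ∀ D a b c d → D * a + D * b + 2 * (D * c) + D * d ≡ D * (a + b + 2 * c + d)
    e₂ = solve-∀

  shift-sum : ∀ a b {c P Q} → a + b ≡ c → a * P ≤ b * Q → a * (Q + P) ≤ c * Q
  shift-sum a b {P = P} {Q} refl le = ≤-trans (≤-reflexive (*-distribˡ-+ a Q P))
    (≤-trans (+-monoʳ-≤ (a * Q) le) (≤-reflexive (sym (*-distribʳ-+ Q a b))))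

  shift-sum′ : ∀ a b {c P Q} → a + b ≡ c → b * Q ≤ a * P → c * Q ≤ a * (Q + P)
  shift-sum′ a b {P = P} {Q} refl le = ≤-trans (≤-reflexive (*-distribʳ-+ Q a b))
    (≤-trans (+-monoʳ-≤ (a * Q) le) (≤-reflexive (sym (*-distribˡ-+ a Q P))))

  reshape : ∀ {A B₁ B₂ C D E F p R} →
            A + B₁ * C * D + 2 * E * F * p + B₂ ≤ R → A + B₁ * C * D + 2 * (E * F * (p * 1)) + B₂ * 1 * 1 ≤ R
  reshape {A} {B₁} {B₂} {C} {D} {E} {F} {p} {R} = subst (_≤ R) (e₁ A B₁ B₂ C D E F p)
    where
    e₁ : ∀ A B₁ B₂ C D E F p → A + B₁ * C * D + 2 * E * F * p + B₂ ≡ A + B₁ * C * D + 2 * (E * F * (p * 1)) + B₂ * 1 * 1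
    e₁ = solve-∀

  -- The four summands of AboveC are at least α₁ R / D, …, α₄ R / D for the right-hand side R.
  no-room : ∀ a b c d α₁ α₂ α₃ α₄ D {T p q} → .{{_ : NonZero b}} → .{{_ : NonZero d}} →
            a * T ≤ b * q ^ 4 → c * p ≤ d * q →
            α₁ * (b ^ 1 * d ^ 1) ≤ D * (a ^ 1 * c ^ 1) → α₂ * (b ^ 4 * d ^ 3) ≤ D * (a ^ 4 * c ^ 3) →
            α₃ * (b ^ 6 * d ^ 4) ≤ D * (a ^ 6 * c ^ 4) → α₄ * (b ^ 8 * d ^ 5) ≤ D * (a ^ 8 * c ^ 5) →
            q ^ 5 * T ^ 7 * p ^ 4 + q ^ 19 * T ^ 4 * p ^ 2 + 2 * q ^ 28 * T ^ 2 * p + q ^ 37 ≤ T ^ 8 * p ^ 5 →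
            (α₁ + α₂ + 2 * α₃ + α₄) * (T ^ 8 * p ^ 5) ≤ D * (T ^ 8 * p ^ 5)
  no-room a b c d α₁ α₂ α₃ α₄ D {T} {p} {q} T≤ p≤ ≤₁ ≤₂ ≤₃ ≤₄ above = sum-bound {T ^ 8 * p ^ 5} {D} α₁ α₂ α₃ α₄
    (term-bound {a} {b} {c} {d} {T} {p} {q} 1 1 7 4 α₁ D T≤ p≤ ≤₁)
    (term-bound {a} {b} {c} {d} {T} {p} {q} 4 3 4 2 α₂ D T≤ p≤ ≤₂)
    (term-bound {a} {b} {c} {d} {T} {p} {q} 6 4 2 1 α₃ D T≤ p≤ ≤₃)
    (term-bound {a} {b} {c} {d} {T} {p} {q} 8 5 0 0 α₄ D T≤ p≤ ≤₄)
    (reshape {q ^ 5 * T ^ 7 * p ^ 4} {q ^ 19} {q ^ 37} {T ^ 4} {p ^ 2} {q ^ 28} {T ^ 2} {p} above)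

  cancel : ∀ {α D R} → 0 < R → α * R ≤ D * R → α ≤ D
  cancel {α} {D} {R} 0<R = *-cancelʳ-≤ α D R {{>-nonZero 0<R}}

-- Otherwise T/q⁴ < 167/100, and p/q ≤ 1131/1250, a fraction just above (67/100)^(1/4). The summands
-- of `AboveC` are then at least 0.66180, 0.17357, 2 · 0.06878 and 0.02725 times its right-hand
-- side, together 1.00018 times it. The margin is small because 1.67 is so close to c.
above⇒ : ∀ p q → 0 < p → 0 < q → AboveC p q → 67 * q ^ 4 ≤ 100 * p ^ 4
above⇒ p q 0<p 0<q above with 67 * q ^ 4 ≤? 100 * p ^ 4
... | yes le = le
... | no ¬le = contradiction (cancel {100018} {100000} {τNum p q ^ 8 * p ^ 5} 0<R
    (no-room 100 167 1250 1131 66180 17357 6878 2725 100000 {τNum p q} {p} {q} T≤ p≤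
    (≤ᵇ⇒≤ (66180 * (167 ^ 1 * 1131 ^ 1)) (100000 * (100 ^ 1 * 1250 ^ 1)) _)
    (≤ᵇ⇒≤ (17357 * (167 ^ 4 * 1131 ^ 3)) (100000 * (100 ^ 4 * 1250 ^ 3)) _)
    (≤ᵇ⇒≤ (6878 * (167 ^ 6 * 1131 ^ 4)) (100000 * (100 ^ 6 * 1250 ^ 4)) _)
    (≤ᵇ⇒≤ (2725 * (167 ^ 8 * 1131 ^ 5)) (100000 * (100 ^ 8 * 1250 ^ 5)) _)
    above))
  (<⇒≱ (≤ᵇ⇒≤ 100001 100018 _))
  where
  below : 100 * p ^ 4 ≤ 67 * q ^ 4
  below = <⇒≤ (≰⇒> ¬le)
  T≤ : 100 * τNum p q ≤ 167 * q ^ 4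
  T≤ = shift-sum 100 67 {167} {p ^ 4} {q ^ 4} refl below
  p≤ : 1250 * p ≤ 1131 * q
  p≤ = root-bound {100} {67} {1250} {1131} {p} {q} below (≤ᵇ⇒≤ (suc (67 * 1250 ^ 4)) (100 * 1131 ^ 4) _) 0<q
  0<R : 0 < τNum p q ^ 8 * p ^ 5
  0<R = *-mono-≤ (m^n>0 (τNum p q) {{>-nonZero (≤-trans (m^n>0 q {{>-nonZero 0<q}} 4) (m≤m+n (q ^ 4) (p ^ 4)))}} 8)
                 (m^n>0 p {{>-nonZero 0<p}} 5)

power-transfer : ∀ {L a c Q T} n .{{_ : NonZero a}} → L * a ^ n ≤ c ^ n → c * Q ≤ a * T → L * Q ^ n ≤ T ^ n
power-transfer {L} {a} {c} {Q} {T} n le le′ = *-cancelʳ-≤ _ _ (a ^ n) {{m^n≢0 a n}} (begin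
  L * Q ^ n * a ^ n   ≡⟨ e₁ L (Q ^ n) (a ^ n) ⟩
  L * a ^ n * Q ^ n   ≤⟨ *-monoˡ-≤ (Q ^ n) le ⟩
  c ^ n * Q ^ n       ≡⟨ sym (*-^ c Q n) ⟩
  (c * Q) ^ n         ≤⟨ ^-monoˡ-≤ n le′ ⟩
  (a * T) ^ n         ≡⟨ *-^ a T n ⟩
  a ^ n * T ^ n       ≡⟨ *-comm (a ^ n) (T ^ n) ⟩
  T ^ n * a ^ n       ∎)
  where
  open ≤-Reasoning
  e₁ : ∀ a b c → a * b * c ≡ a * c * b
  e₁ = solve-∀

theorem2p3 : (n p q : ℕ) → 0 < p → 0 < q → AboveC p q →
    ((T : Theory n) → IsCNF 3 T →
    (ms : List (Subset n)) → Unique ms → All (IsMinimalModel T) ms →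
    AtMostτPow n p q (length ms))
    × ((P : NProgram n) → IsNormalProgram 3 P →
    (ms : List (Subset n)) → Unique ms → All (IsStableModel P) ms →
    AtMostτPow n p q (length ms))
    × ((P : DProgram n) → IsDisjunctiveProgram 3 P →
    (ms : List (Subset n)) → Unique ms → All (IsAnswerSet P) ms →
    AtMostτPow n p q (length ms))
theorem2p3 n p q 0<p 0<q above =
  (λ T → models) ,
  (λ P ok ms u stable → answers (disjunctive-ok ok) u (All.map (stable⇒answer-set {P = P}) stable)) ,
  (λ P ok ms → answers ok)
  where
  models : ∀ {T : Theory n} → IsCNF 3 T → ∀ ms → Unique ms → All (IsMinimalModel T) ms → AtMostτPow n p q (length ms)
  models cnf ms u all = power-transfer {length ms} {100} {167} {q ^ 4} {τNum p q} n (count-minimal-models cnf u all)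
    (shift-sum′ 100 67 {167} {p ^ 4} {q ^ 4} refl (above⇒ p q 0<p 0<q above))
  answers : ∀ {P : DProgram n} → IsDisjunctiveProgram 3 P → ∀ {ms} → Unique ms → All (IsAnswerSet P) ms → AtMostτPow n p q (length ms)
  answers {P} ok {ms} u all = models (ruleTheory-cnf {P = P} ok) ms u (All.map (answer-set⇒minimal {P = P}) all)
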